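{- Let $k\ge0$, let $T$ be a semi-classical arithmetic, and let $X$ be a set of sentences of the language of $\mathsf{HA}$ all belonging to $\mathcal{Q}_{k+1}$. The following are pairwise equivalent: (1) $\mathsf{PA}+X$ is $\mathrm{U}_{k+1}$-conservative over $T+X$; (2) $\mathsf{PA}+X$ is $\mathrm{E}\Pi_{k+1}$-conservative over $T+X$; (3) $T+X$ is closed under $\mathrm{DNE\text{ - }R}(\mathrm{E}\Pi_{k+1})$; (4) $T+X$ is closed under $\mathrm{CD\text{ - }R}(\mathrm{E}\Pi_{k+1})$; (5) $T+X$ is closed under $\mathrm{DNE\text{ - }R}(\mathrm{U}_{k+1})$; (6) $T+X$ is closed under $\mathrm{CD\text{ - }R}(\mathrm{U}_{k+1})$.
   Context: $\mathsf{HA}$ is intuitionistic first-order arithmetic with function symbols for all primitive recursive functions and logical constants $\forall,\exists,\to,\land,\lor,\perp$ ($\neg\varphi:\equiv\varphi\to\perp$); $\mathsf{PA}$ is $\mathsf{HA}$ plus excluded middle for all formulas. A semi-classical arithmetic is a theory $T$ in the language of $\mathsf{HA}$ with $\mathsf{HA}\subseteq T\subseteq\mathsf{PA}$; $T+X$ adds the sentences of $X$ as axioms. $T'$ is $\Gamma$-conservative over $T$ if every formula of $\Gamma$ provable in $T'$ is provable in $T$. $\Sigma_0=\Pi_0$ = quantifier-free formulas; $\Sigma_{k+1}$ = formulas $\exists x_1\cdots\exists x_n\varphi$, $\varphi\in\Pi_k$; $\Pi_{k+1}$ = formulas $\forall x_1\cdots\forall x_n\varphi$, $\varphi\in\Sigma_k$.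 $\mathrm{E}\Pi_k$ is the smallest class containing $\Pi_k$ and closed under $\varphi,\psi\mapsto\varphi\lor\psi$ and $\varphi\mapsto\forall x\varphi$. Rules (formulas may contain free variables): $T$ is closed under $\mathrm{DNE\text{ - }R}(\Gamma)$ if $T\vdash\neg\neg\varphi$ implies $T\vdash\varphi$ for all $\varphi\in\Gamma$; closed under $\mathrm{CD\text{ - }R}(\Gamma)$ if $T\vdash\forall x(\varphi\lor\psi)$ implies $T\vdash\varphi\lor\forall x\psi$ for all $\varphi,\psi\in\Gamma$ with $x$ not free in $\varphi$. Degree: an alternation path is a finite sequence of symbols $+,-$ in which they alternate; $i(s)$ is the first symbol of $s$ if nonempty and $\times$ if empty, $s^\perp$ swaps $+$ and $-$, $l(s)$ is the length. $\mathrm{Alt}(\varphi)=\{\langle\rangle\}$ for quantifier-free $\varphi$; otherwise $\mathrm{Alt}(\varphi_1\land\varphi_2)=\mathrm{Alt}(\varphi_1\lor\varphi_2)=\mathrm{Alt}(\varphi_1)\cup\mathrm{Alt}(\varphi_2)$, $\mathrm{Alt}(\varphi_1\to\varphi_2)=\{s^\perp:s\in\mathrm{Alt}(\varphi_1)\}\cup\mathrm{Alt}(\varphi_2)$, $\mathrm{Alt}(\forall x\varphi_1)=\{s\in\mathrm{Alt}(\varphi_1):i(s)=-\}\cup\{ -s:s\in\mathrm{Alt}(\varphi_1),i(s)\ne-\}$, $\mathrm{Alt}(\exists x\varphi_1)=\{s\in\mathrm{Alt}(\varphi_1):i(s)=+\}\cup\{+s:s\in\mathrm{Alt}(\varphi_1),i(s)\ne+\}$.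 $\deg(\varphi)=\max\{l(s):s\in\mathrm{Alt}(\varphi)\}$; $\mathrm{F}_k^+$ = formulas of degree $\le k$; $\mathrm{U}_{k+1}$ = formulas of degree exactly $k+1$ such that $i(s)=-$ for all $s\in\mathrm{Alt}(\varphi)$ with $l(s)=k+1$. $\mathcal{R}_0=\mathcal{J}_0=\Sigma_0$; $\mathcal{R}_{k+1},\mathcal{J}_{k+1}$ are simultaneously generated by: every formula of $\mathrm{F}_k^+$ is in both; for $R,R'\in\mathcal{R}_{k+1}$, $J,J'\in\mathcal{J}_{k+1}$: $R\land R',R\lor R',\forall xR,J\to R\in\mathcal{R}_{k+1}$ and $J\land J',J\lor J',\exists xJ,R\to J\in\mathcal{J}_{k+1}$. $\mathcal{Q}_0=\Sigma_0$; $\mathcal{Q}_{k+1}$ is generated by prime formulas and closure under $\land,\lor,\forall x,\exists x$, and $J\to Q$ for $J\in\mathcal{J}_{k+1}$, $Q\in\mathcal{Q}_{k+1}$. -}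

module Defs where

open import Data.Nat using (ℕ; zero; suc; _≤_; _<_; _⊔_)
open import Data.Fin using (Fin; toℕ)
open import Data.Vec using (Vec; []; _∷_; tabulate)
open import Data.List using (List; []; _∷_; [_]; _++_; map; length; foldr)
open import Data.List.Membership.Propositional using (_∈_)
open import Data.Bool using (Bool; true; false; _∧_; if_then_else_)
open import Data.Product using (_×_)
open import Data.Sum using (_⊎_)
open import Data.Empty using (⊥)
open import Data.Unit using (⊤)
open import Relation.Binary.PropositionalEquality using (_≡_; _≢_)
open import Function.Bundles using (_⇔_)

data PR : ℕ → Set where
  zeroF : PR 0
  succF : PR 1
  proj  : ∀ {n} → Fin n → PR n
  comp  : ∀ {n m} → PR m → Vec (PR n) m → PR n
  prec  : ∀ {n} → PR n → PR (suc (suc n)) → PR (suc n)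
  -- prec g h : f(0, y) = g(y),  f(x+1, y) = h(f(x, y), x, y)

data Term : Set where
  var : ℕ → Term
  app : ∀ {n} → PR n → Vec Term n → Term

infix  7 _≐_
infixr 6 _∧'_
infixr 5 _∨'_
infixr 4 _⇒_

data Formula : Set where
  _≐_  : Term → Term → Formula
  ⊥'   : Formula
  _∧'_ : Formula → Formula → Formula
  _∨'_ : Formula → Formula → Formula
  _⇒_  : Formula → Formula → Formula
  ∀'   : Formula → Formula
  ∃'   : Formula → Formula

¬' : Formula → Formula
¬' φ = φ ⇒ ⊥'

zeroT : Term
zeroT = app zeroF []

succT : Term → Term
succT t = app succF (t ∷ [])

Subst : Set
Subst = ℕ → Term

mutual
  substT : Subst → Term → Term
  substT σ (var x)    = σ x
  substT σ (app f ts) = app f (substTs σ ts)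

  substTs : ∀ {n} → Subst → Vec Term n → Vec Term n
  substTs σ []       = []
  substTs σ (t ∷ ts) = substT σ t ∷ substTs σ ts

shiftT : Term → Term
shiftT = substT (λ x → var (suc x))

lift : Subst → Subst
lift σ zero    = var zero
lift σ (suc x) = shiftT (σ x)

subst : Subst → Formula → Formula
subst σ (t ≐ s)  = substT σ t ≐ substT σ s
subst σ ⊥'       = ⊥'
subst σ (φ ∧' ψ) = subst σ φ ∧' subst σ ψ
subst σ (φ ∨' ψ) = subst σ φ ∨' subst σ ψ
subst σ (φ ⇒ ψ)  = subst σ φ ⇒ subst σ ψ
subst σ (∀' φ)   = ∀' (subst (lift σ) φ)
subst σ (∃' φ)   = ∃' (subst (lift σ) φ)

shift : Formula → Formula
shift = subst (λ x → var (suc x))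

sub0 : Term → Subst
sub0 t zero    = t
sub0 t (suc x) = var x

_[_]₀ : Formula → Term → Formula
φ [ t ]₀ = subst (sub0 t) φ

mutual
  FVBelowT : ℕ → Term → Set
  FVBelowT n (var x)    = x < n
  FVBelowT n (app f ts) = FVBelowTs n ts

  FVBelowTs : ∀ {m} → ℕ → Vec Term m → Set
  FVBelowTs n []       = ⊤
  FVBelowTs n (t ∷ ts) = FVBelowT n t × FVBelowTs n ts

FVBelow : ℕ → Formula → Set
FVBelow n (t ≐ s)  = FVBelowT n t × FVBelowT n s
FVBelow n ⊥'       = ⊤
FVBelow n (φ ∧' ψ) = FVBelow n φ × FVBelow n ψ
FVBelow n (φ ∨' ψ) = FVBelow n φ × FVBelow n ψ
FVBelow n (φ ⇒ ψ)  = FVBelow n φ × FVBelow n ψ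
FVBelow n (∀' φ)   = FVBelow (suc n) φ
FVBelow n (∃' φ)   = FVBelow (suc n) φ

Sentence : Formula → Set
Sentence = FVBelow 0

vars : (n : ℕ) → Vec Term n
vars n = tabulate (λ i → var (toℕ i))

σL₀ σL₁ : Subst
σL₀ zero    = var 0
σL₀ (suc x) = var (suc (suc x))
σL₁ zero    = var 1
σL₁ (suc x) = var (suc (suc x))

σS : Subst
σS zero    = succT (var 0)
σS (suc x) = var (suc x)

data HAAx : Formula → Set where
  eq-refl  : HAAx (var 0 ≐ var 0)
  leibniz  : ∀ φ → HAAx (var 0 ≐ var 1 ⇒ subst σL₀ φ ⇒ subst σL₁ φ)
  succ-ne0 : HAAx (¬' (succT (var 0) ≐ zeroT))
  succ-inj : HAAx (succT (var 0) ≐ succT (var 1) ⇒ var 0 ≐ var 1)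
  def-proj : ∀ {n} (i : Fin n) → HAAx (app (proj i) (vars n) ≐ var (toℕ i))
  def-comp : ∀ {n m} (g : PR m) (hs : Vec (PR n) m) →
             HAAx (app (comp g hs) (vars n) ≐ app g (Data.Vec.map (λ h → app h (vars n)) hs))
  def-rec0 : ∀ {n} (g : PR n) (h : PR (suc (suc n))) →
             HAAx (app (prec g h) (zeroT ∷ vars n) ≐ app g (vars n))
  def-recS : ∀ {n} (g : PR n) (h : PR (suc (suc n))) →
             HAAx (app (prec g h) (succT (var n) ∷ vars n)
                   ≐ app h (app (prec g h) (var n ∷ vars n) ∷ var n ∷ vars n))
  induction : ∀ φ → HAAx (φ [ zeroT ]₀ ⇒ ∀' (φ ⇒ subst σS φ) ⇒ ∀' φ)

-- Intuitionistic natural deduction over an axiom set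
-- (axioms may be used in any substitution instance, i.e. open axioms
-- are read as their universal closures)

shiftCtx : List Formula → List Formula
shiftCtx = map shift

data Der (Ax : Formula → Set) : List Formula → Formula → Set where
  hyp  : ∀ {Γ φ} → φ ∈ Γ → Der Ax Γ φ
  ax   : ∀ {Γ φ} → Ax φ → (σ : Subst) → Der Ax Γ (subst σ φ)
  ⊥E   : ∀ {Γ φ} → Der Ax Γ ⊥' → Der Ax Γ φ
  ∧I   : ∀ {Γ φ ψ} → Der Ax Γ φ → Der Ax Γ ψ → Der Ax Γ (φ ∧' ψ)
  ∧E₁  : ∀ {Γ φ ψ} → Der Ax Γ (φ ∧' ψ) → Der Ax Γ φ
  ∧E₂  : ∀ {Γ φ ψ} → Der Ax Γ (φ ∧' ψ) → Der Ax Γ ψ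
  ∨I₁  : ∀ {Γ φ ψ} → Der Ax Γ φ → Der Ax Γ (φ ∨' ψ)
  ∨I₂  : ∀ {Γ φ ψ} → Der Ax Γ ψ → Der Ax Γ (φ ∨' ψ)
  ∨E   : ∀ {Γ φ ψ χ} → Der Ax Γ (φ ∨' ψ) → Der Ax (φ ∷ Γ) χ → Der Ax (ψ ∷ Γ) χ → Der Ax Γ χ
  ⇒I   : ∀ {Γ φ ψ} → Der Ax (φ ∷ Γ) ψ → Der Ax Γ (φ ⇒ ψ)
  ⇒E   : ∀ {Γ φ ψ} → Der Ax Γ (φ ⇒ ψ) → Der Ax Γ φ → Der Ax Γ ψ
  ∀I   : ∀ {Γ φ} → Der Ax (shiftCtx Γ) φ → Der Ax Γ (∀' φ)
  ∀E   : ∀ {Γ φ} → Der Ax Γ (∀' φ) → (t : Term) → Der Ax Γ (φ [ t ]₀)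
  ∃I   : ∀ {Γ φ} (t : Term) → Der Ax Γ (φ [ t ]₀) → Der Ax Γ (∃' φ)
  ∃E   : ∀ {Γ φ ψ} → Der Ax Γ (∃' φ) → Der Ax (φ ∷ shiftCtx Γ) (shift ψ) → Der Ax Γ ψ

-- Theories: a theory is given by its extra axioms over HA

Theory : Set₁
Theory = Formula → Set

_⊢_ : Theory → Formula → Set
T ⊢ φ = Der (λ ψ → HAAx ψ ⊎ T ψ) [] φ

_+_ : Theory → Theory → Theory
(T + X) φ = T φ ⊎ X φ

HA : Theory
HA _ = ⊥

data LEM : Formula → Set where
  lem : ∀ φ → LEM (φ ∨' ¬' φ)

PA : Theory
PA = LEM

-- HA ⊆ T holds by construction; T ⊆ PA
SemiClassical : Theory → Set
SemiClassical T = ∀ φ → T φ → PA ⊢ φ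

Conservative : (Formula → Set) → Theory → Theory → Set
Conservative Γ T' T = ∀ φ → Γ φ → T' ⊢ φ → T ⊢ φ

DNE-R : (Formula → Set) → Theory → Set
DNE-R Γ T = ∀ φ → Γ φ → T ⊢ ¬' (¬' φ) → T ⊢ φ

-- x (de Bruijn variable 0 under ∀') not free in φ: φ appears shifted
CD-R : (Formula → Set) → Theory → Set
CD-R Γ T = ∀ φ ψ → Γ φ → Γ ψ → T ⊢ ∀' (shift φ ∨' ψ) → T ⊢ (φ ∨' ∀' ψ)

data QF : Formula → Set where
  qf-eq : ∀ {t s} → QF (t ≐ s)
  qf-⊥  : QF ⊥'
  qf-∧  : ∀ {φ ψ} → QF φ → QF ψ → QF (φ ∧' ψ)
  qf-∨  : ∀ {φ ψ} → QF φ → QF ψ → QF (φ ∨' ψ)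
  qf-⇒  : ∀ {φ ψ} → QF φ → QF ψ → QF (φ ⇒ ψ)

mutual
  data Σₖ : ℕ → Formula → Set where
    Σ-qf : ∀ {φ} → QF φ → Σₖ 0 φ
    Σ-Π  : ∀ {k φ} → Πₖ k φ → Σₖ (suc k) φ
    Σ-∃  : ∀ {k φ} → Σₖ (suc k) φ → Σₖ (suc k) (∃' φ)

  data Πₖ : ℕ → Formula → Set where
    Π-qf : ∀ {φ} → QF φ → Πₖ 0 φ
    Π-Σ  : ∀ {k φ} → Σₖ k φ → Πₖ (suc k) φ
    Π-∀  : ∀ {k φ} → Πₖ (suc k) φ → Πₖ (suc k) (∀' φ)

data EΠ (k : ℕ) : Formula → Set where
  eπ-base : ∀ {φ} → Πₖ k φ → EΠ k φ
  eπ-∨    : ∀ {φ ψ} → EΠ k φ → EΠ k ψ → EΠ k (φ ∨' ψ)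
  eπ-∀    : ∀ {φ} → EΠ k φ → EΠ k (∀' φ)

data Sign : Set where
  plus minus : Sign

AltPath : Set
AltPath = List Sign

data Init : Set where
  ini : Sign → Init
  none : Init

i : AltPath → Init
i []      = none
i (s ∷ _) = ini s

flipS : Sign → Sign
flipS plus  = minus
flipS minus = plus

_⊥ₛ : AltPath → AltPath
s ⊥ₛ = map flipS s

cons : Sign → AltPath → AltPath
cons plus  (plus ∷ s)  = plus ∷ s
cons minus (minus ∷ s) = minus ∷ s
cons a     s           = a ∷ s

isQF : Formula → Bool
isQF (_ ≐ _)  = true
isQF ⊥'       = true
isQF (φ ∧' ψ) = isQF φ ∧ isQF ψ
isQF (φ ∨' ψ) = isQF φ ∧ isQF ψ
isQF (φ ⇒ ψ)  = isQF φ ∧ isQF ψ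
isQF (∀' _)   = false
isQF (∃' _)   = false

-- Alt(φ), represented as a list (a finite set)
Alt : Formula → List AltPath
Alt φ = if isQF φ then [ [] ] else Alt' φ
  where
  Alt' : Formula → List AltPath
  Alt' (_ ≐ _)  = [ [] ]
  Alt' ⊥'       = [ [] ]
  Alt' (φ ∧' ψ) = Alt φ ++ Alt ψ
  Alt' (φ ∨' ψ) = Alt φ ++ Alt ψ
  Alt' (φ ⇒ ψ)  = map _⊥ₛ (Alt φ) ++ Alt ψ
  Alt' (∀' φ)   = map (cons minus) (Alt φ)
  Alt' (∃' φ)   = map (cons plus) (Alt φ)

deg : Formula → ℕ
deg φ = foldr _⊔_ 0 (map length (Alt φ))

F⁺ : ℕ → Formula → Set
F⁺ k φ = deg φ ≤ k

U : ℕ → Formula → Set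
U k φ = deg φ ≡ suc k × (∀ s → s ∈ Alt φ → length s ≡ suc k → i s ≡ ini minus)
-- U k φ  denotes  φ ∈ U_{k+1}

-- Classes R, J, Q  (index k denotes R_{k+1}, J_{k+1}, Q_{k+1})

mutual
  data Rₛ (k : ℕ) : Formula → Set where
    R-F : ∀ {φ} → F⁺ k φ → Rₛ k φ
    R-∧ : ∀ {φ ψ} → Rₛ k φ → Rₛ k ψ → Rₛ k (φ ∧' ψ)
    R-∨ : ∀ {φ ψ} → Rₛ k φ → Rₛ k ψ → Rₛ k (φ ∨' ψ)
    R-∀ : ∀ {φ} → Rₛ k φ → Rₛ k (∀' φ)
    R-⇒ : ∀ {φ ψ} → Jₛ k φ → Rₛ k ψ → Rₛ k (φ ⇒ ψ)

  data Jₛ (k : ℕ) : Formula → Set where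
    J-F : ∀ {φ} → F⁺ k φ → Jₛ k φ
    J-∧ : ∀ {φ ψ} → Jₛ k φ → Jₛ k ψ → Jₛ k (φ ∧' ψ)
    J-∨ : ∀ {φ ψ} → Jₛ k φ → Jₛ k ψ → Jₛ k (φ ∨' ψ)
    J-∃ : ∀ {φ} → Jₛ k φ → Jₛ k (∃' φ)
    J-⇒ : ∀ {φ ψ} → Rₛ k φ → Jₛ k ψ → Jₛ k (φ ⇒ ψ)

data Qₛ (k : ℕ) : Formula → Set where
  Q-eq : ∀ {t s} → Qₛ k (t ≐ s)
  Q-⊥  : Qₛ k ⊥'
  Q-∧  : ∀ {φ ψ} → Qₛ k φ → Qₛ k ψ → Qₛ k (φ ∧' ψ)
  Q-∨  : ∀ {φ ψ} → Qₛ k φ → Qₛ k ψ → Qₛ k (φ ∨' ψ)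
  Q-∀  : ∀ {φ} → Qₛ k φ → Qₛ k (∀' φ)
  Q-∃  : ∀ {φ} → Qₛ k φ → Qₛ k (∃' φ)
  Q-⇒  : ∀ {φ ψ} → Jₛ k φ → Qₛ k ψ → Qₛ k (φ ⇒ ψ)

{-# OPTIONS --safe #-}
module Submission where

-- Padding with a provable formula of degree k+1 turns EΠ_{k+1} formulas into U_{k+1} formulas,
-- and ∀x(φ ∨ ψ) implies ¬¬(φ ∨ ∀xψ), so everything reduces to: closure under CD-R(EΠ_{k+1})
-- makes PA + X conservative over T + X for U_{k+1}.
-- (a) CD-R applied to ∀x(∃xφ ∨ ¬φ) yields Σ_j-LEM for j = 0, …, k successively, so that every
--     formula of degree ≤ k is decidable in T + X, hence equivalent to its Gödel–Gentzen translation.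
-- (b) Then R → R^N and J^N → ¬¬J for R ∈ R_{k+1}, J ∈ J_{k+1}, whence Q → Q^N for Q ∈ Q_{k+1}: the
--     translation interprets PA + X in T + X, which gives conservativity for Σ_k.
-- (c) An EΠ_{k+1} formula is taken apart inside PA + X down to a disjunction of Σ_k formulas and
--     rebuilt inside T + X, where CD-R moves each ∀ back into its disjunct.
-- (d) Every U_{k+1} formula φ has a conjunction ψ of EΠ_{k+1} formulas with T + X ⊢ ψ → φ and
--     PA + X ⊢ φ → ψ, obtained by pushing negations inwards.

open import Defs
open import Data.Bool using (true; false)
open import Data.Empty using (⊥-elim)
open import Data.List using (List; []; _∷_; [_]; map; length; foldr)
open import Data.List.Membership.Propositional using (_∈_)
open import Data.List.Membership.Propositional.Properties using (∈-map⁺; ∈-map⁻; ∈-++⁺ˡ; ∈-++⁺ʳ; ∈-++⁻)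
open import Data.List.Properties using (map-∘; map-cong)
open import Data.List.Relation.Binary.Subset.Propositional using (_⊆_)
open import Data.List.Relation.Binary.Subset.Propositional.Properties using (map⁺; ∷⁺ʳ)
open import Data.List.Relation.Unary.Any using (here; there)
open import Data.Nat using (ℕ; zero; suc; _≤_; _<_; z≤n; s≤s; _⊔_; _≤′_; ≤′-refl; ≤′-step)
open import Data.Nat.Properties using (≤-refl; ≤-trans; ≤-reflexive; ≤-antisym; n≤1+n; m≤m⊔n; m≤n⊔m; ⊔-lub; 1+n≰n; m≤n⇒m<n∨m≡n; <⇒≤; ≤⇒≤′)
open import Data.Product using (_×_; _,_; proj₁; proj₂; ∃-syntax)
open import Data.Sum using (_⊎_; inj₁; inj₂)
open import Data.Vec using (Vec; []; _∷_)
open import Function using (_∘_)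
open import Function.Bundles using (_⇔_; mk⇔)
open import Relation.Binary.PropositionalEquality as ≡ using (_≡_; refl; sym; trans; cong; cong₂)
open import Relation.Nullary using (¬_)

-- Substitution calculus

wk : Subst
wk x = var (suc x)

infixr 9 _⊙_
_⊙_ : Subst → Subst → Subst
(τ ⊙ σ) x = substT τ (σ x)

infix 4 _≗ₛ_
_≗ₛ_ : Subst → Subst → Set
σ ≗ₛ τ = ∀ x → σ x ≡ τ x

mutual
  substT-cong : ∀ {σ τ} → σ ≗ₛ τ → ∀ t → substT σ t ≡ substT τ t
  substT-cong e (var x)    = e x
  substT-cong e (app f ts) = cong (app f) (substTs-cong e ts)

  substTs-cong : ∀ {σ τ n} → σ ≗ₛ τ → (ts : Vec Term n) → substTs σ ts ≡ substTs τ ts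
  substTs-cong e []       = refl
  substTs-cong e (t ∷ ts) = cong₂ _∷_ (substT-cong e t) (substTs-cong e ts)

mutual
  substT-⊙ : ∀ τ σ t → substT τ (substT σ t) ≡ substT (τ ⊙ σ) t
  substT-⊙ τ σ (var x)    = refl
  substT-⊙ τ σ (app f ts) = cong (app f) (substTs-⊙ τ σ ts)

  substTs-⊙ : ∀ {n} τ σ (ts : Vec Term n) → substTs τ (substTs σ ts) ≡ substTs (τ ⊙ σ) ts
  substTs-⊙ τ σ []       = refl
  substTs-⊙ τ σ (t ∷ ts) = cong₂ _∷_ (substT-⊙ τ σ t) (substTs-⊙ τ σ ts)

mutual
  substT-id : ∀ t → substT var t ≡ t
  substT-id (var x)    = refl
  substT-id (app f ts) = cong (app f) (substTs-id ts)

  substTs-id : ∀ {n} (ts : Vec Term n) → substTs var ts ≡ ts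
  substTs-id []       = refl
  substTs-id (t ∷ ts) = cong₂ _∷_ (substT-id t) (substTs-id ts)

lift-cong : ∀ {σ τ} → σ ≗ₛ τ → lift σ ≗ₛ lift τ
lift-cong e zero    = refl
lift-cong e (suc x) = cong shiftT (e x)

lift-⊙ : ∀ τ σ → lift τ ⊙ lift σ ≗ₛ lift (τ ⊙ σ)
lift-⊙ τ σ zero    = refl
lift-⊙ τ σ (suc x) = trans (substT-⊙ (lift τ) wk (σ x)) (sym (substT-⊙ wk τ (σ x)))

lift-id : lift var ≗ₛ var
lift-id zero    = refl
lift-id (suc x) = refl

subst-cong : ∀ {σ τ} → σ ≗ₛ τ → ∀ φ → subst σ φ ≡ subst τ φ
subst-cong e (t ≐ s)  = cong₂ _≐_ (substT-cong e t) (substT-cong e s)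
subst-cong e ⊥'       = refl
subst-cong e (φ ∧' ψ) = cong₂ _∧'_ (subst-cong e φ) (subst-cong e ψ)
subst-cong e (φ ∨' ψ) = cong₂ _∨'_ (subst-cong e φ) (subst-cong e ψ)
subst-cong e (φ ⇒ ψ)  = cong₂ _⇒_ (subst-cong e φ) (subst-cong e ψ)
subst-cong e (∀' φ)   = cong ∀' (subst-cong (lift-cong e) φ)
subst-cong e (∃' φ)   = cong ∃' (subst-cong (lift-cong e) φ)

subst-⊙ : ∀ τ σ φ → subst τ (subst σ φ) ≡ subst (τ ⊙ σ) φ
subst-⊙ τ σ (t ≐ s)  = cong₂ _≐_ (substT-⊙ τ σ t) (substT-⊙ τ σ s)
subst-⊙ τ σ ⊥'       = refl
subst-⊙ τ σ (φ ∧' ψ) = cong₂ _∧'_ (subst-⊙ τ σ φ) (subst-⊙ τ σ ψ)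
subst-⊙ τ σ (φ ∨' ψ) = cong₂ _∨'_ (subst-⊙ τ σ φ) (subst-⊙ τ σ ψ)
subst-⊙ τ σ (φ ⇒ ψ)  = cong₂ _⇒_ (subst-⊙ τ σ φ) (subst-⊙ τ σ ψ)
subst-⊙ τ σ (∀' φ)   = cong ∀' (trans (subst-⊙ (lift τ) (lift σ) φ) (subst-cong (lift-⊙ τ σ) φ))
subst-⊙ τ σ (∃' φ)   = cong ∃' (trans (subst-⊙ (lift τ) (lift σ) φ) (subst-cong (lift-⊙ τ σ) φ))

subst-id : ∀ φ → subst var φ ≡ φ
subst-id (t ≐ s)  = cong₂ _≐_ (substT-id t) (substT-id s)
subst-id ⊥'       = refl
subst-id (φ ∧' ψ) = cong₂ _∧'_ (subst-id φ) (subst-id ψ)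
subst-id (φ ∨' ψ) = cong₂ _∨'_ (subst-id φ) (subst-id ψ)
subst-id (φ ⇒ ψ)  = cong₂ _⇒_ (subst-id φ) (subst-id ψ)
subst-id (∀' φ)   = cong ∀' (trans (subst-cong lift-id φ) (subst-id φ))
subst-id (∃' φ)   = cong ∃' (trans (subst-cong lift-id φ) (subst-id φ))

subst-subst : ∀ {τ σ τ′ σ′} → τ ⊙ σ ≗ₛ τ′ ⊙ σ′ → ∀ φ → subst τ (subst σ φ) ≡ subst τ′ (subst σ′ φ)
subst-subst {τ} {σ} {τ′} {σ′} e φ =
  trans (subst-⊙ τ σ φ) (trans (subst-cong e φ) (sym (subst-⊙ τ′ σ′ φ)))

subst-shift : ∀ σ φ → subst (lift σ) (shift φ) ≡ shift (subst σ φ)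
subst-shift σ = subst-subst (λ _ → refl)

subst-sub0 : ∀ σ φ t → subst σ (φ [ t ]₀) ≡ subst (lift σ) φ [ substT σ t ]₀
subst-sub0 σ φ t = subst-subst pointwise φ
  where
  pointwise : σ ⊙ sub0 t ≗ₛ sub0 (substT σ t) ⊙ lift σ
  pointwise zero    = refl
  pointwise (suc x) = sym (trans (substT-⊙ (sub0 (substT σ t)) wk (σ x)) (substT-id (σ x)))

shift-sub0 : ∀ φ t → shift φ [ t ]₀ ≡ φ
shift-sub0 φ t = trans (subst-⊙ (sub0 t) wk φ) (subst-id φ)

-- The eigenvariable identity: under a shifted context a bound variable is opened as `var 0`, and
-- the body then reappears unchanged.
lift-wk-sub0 : ∀ φ → subst (lift wk) φ [ var 0 ]₀ ≡ φ
lift-wk-sub0 φ = trans (subst-⊙ (sub0 (var 0)) (lift wk) φ) (trans (subst-cong pointwise φ) (subst-id φ))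
  where
  pointwise : sub0 (var 0) ⊙ lift wk ≗ₛ var
  pointwise zero    = refl
  pointwise (suc x) = refl

shiftCtx-subst : ∀ σ Γ → map (subst (lift σ)) (shiftCtx Γ) ≡ shiftCtx (map (subst σ) Γ)
shiftCtx-subst σ Γ = trans (sym (map-∘ Γ)) (trans (map-cong (subst-shift σ) Γ) (map-∘ Γ))

-- Structural rules

weaken : ∀ {Ax Γ Δ φ} → Γ ⊆ Δ → Der Ax Γ φ → Der Ax Δ φ
weaken s (hyp p)     = hyp (s p)
weaken s (ax a σ)    = ax a σ
weaken s (⊥E d)      = ⊥E (weaken s d)
weaken s (∧I d e)    = ∧I (weaken s d) (weaken s e)
weaken s (∧E₁ d)     = ∧E₁ (weaken s d)
weaken s (∧E₂ d)     = ∧E₂ (weaken s d)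
weaken s (∨I₁ d)     = ∨I₁ (weaken s d)
weaken s (∨I₂ d)     = ∨I₂ (weaken s d)
weaken s (∨E d e f)  = ∨E (weaken s d) (weaken (∷⁺ʳ _ s) e) (weaken (∷⁺ʳ _ s) f)
weaken s (⇒I d)      = ⇒I (weaken (∷⁺ʳ _ s) d)
weaken s (⇒E d e)    = ⇒E (weaken s d) (weaken s e)
weaken s (∀I d)      = ∀I (weaken (map⁺ shift s) d)
weaken s (∀E d t)    = ∀E (weaken s d) t
weaken s (∃I t d)    = ∃I t (weaken s d)
weaken s (∃E d e)    = ∃E (weaken s d) (weaken (∷⁺ʳ _ (map⁺ shift s)) e)

Der-cong : ∀ {Ax Γ Δ φ ψ} → Γ ≡ Δ → φ ≡ ψ → Der Ax Γ φ → Der Ax Δ ψ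
Der-cong refl refl d = d

cast : ∀ {Ax Γ φ ψ} → φ ≡ ψ → Der Ax Γ φ → Der Ax Γ ψ
cast = Der-cong refl

substDer : ∀ {Ax Γ φ} σ → Der Ax Γ φ → Der Ax (map (subst σ) Γ) (subst σ φ)
substDer σ (hyp p)     = hyp (∈-map⁺ (subst σ) p)
substDer σ (ax {φ = φ} a τ) = cast (sym (subst-⊙ σ τ φ)) (ax a (σ ⊙ τ))
substDer σ (⊥E d)      = ⊥E (substDer σ d)
substDer σ (∧I d e)    = ∧I (substDer σ d) (substDer σ e)
substDer σ (∧E₁ d)     = ∧E₁ (substDer σ d)
substDer σ (∧E₂ d)     = ∧E₂ (substDer σ d)
substDer σ (∨I₁ d)     = ∨I₁ (substDer σ d)
substDer σ (∨I₂ d)     = ∨I₂ (substDer σ d)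
substDer σ (∨E d e f)  = ∨E (substDer σ d) (substDer σ e) (substDer σ f)
substDer σ (⇒I d)      = ⇒I (substDer σ d)
substDer σ (⇒E d e)    = ⇒E (substDer σ d) (substDer σ e)
substDer σ (∀I {Γ} d)  = ∀I (Der-cong (shiftCtx-subst σ Γ) refl (substDer (lift σ) d))
substDer σ (∀E {φ = φ} d t) = cast (sym (subst-sub0 σ φ t)) (∀E (substDer σ d) (substT σ t))
substDer σ (∃I {φ = φ} t d) = ∃I (substT σ t) (cast (subst-sub0 σ φ t) (substDer σ d))
substDer σ (∃E {Γ} {φ} {ψ} d e) =
  ∃E (substDer σ d)
     (Der-cong (cong (subst (lift σ) φ ∷_) (shiftCtx-subst σ Γ)) (subst-shift σ ψ) (substDer (lift σ) e))

thm : ∀ {Ax Γ φ} → Der Ax [] φ → Der Ax Γ φ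
thm = weaken (λ ())

axiom : ∀ {Ax Γ φ} → Ax φ → Der Ax Γ φ
axiom {φ = φ} a = cast (subst-id φ) (ax a var)

-- Replacements are required in the empty context, so that `substDer` can turn each of them into the
-- instance demanded by `ax a σ`.
mapAx : ∀ {Ax Ax′ Γ φ} → (∀ {ψ} → Ax ψ → Der Ax′ [] ψ) → Der Ax Γ φ → Der Ax′ Γ φ
mapAx f (hyp p)     = hyp p
mapAx f (ax a σ)    = thm (substDer σ (f a))
mapAx f (⊥E d)      = ⊥E (mapAx f d)
mapAx f (∧I d e)    = ∧I (mapAx f d) (mapAx f e)
mapAx f (∧E₁ d)     = ∧E₁ (mapAx f d)
mapAx f (∧E₂ d)     = ∧E₂ (mapAx f d)
mapAx f (∨I₁ d)     = ∨I₁ (mapAx f d)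
mapAx f (∨I₂ d)     = ∨I₂ (mapAx f d)
mapAx f (∨E d e g)  = ∨E (mapAx f d) (mapAx f e) (mapAx f g)
mapAx f (⇒I d)      = ⇒I (mapAx f d)
mapAx f (⇒E d e)    = ⇒E (mapAx f d) (mapAx f e)
mapAx f (∀I d)      = ∀I (mapAx f d)
mapAx f (∀E d t)    = ∀E (mapAx f d) t
mapAx f (∃I t d)    = ∃I t (mapAx f d)
mapAx f (∃E d e)    = ∃E (mapAx f d) (mapAx f e)

-- Intuitionistic logic

module _ {Ax : Formula → Set} where

  h0 : ∀ {Γ α} → Der Ax (α ∷ Γ) α
  h0 = hyp (here refl)

  h1 : ∀ {Γ α β} → Der Ax (β ∷ α ∷ Γ) α
  h1 = hyp (there (here refl))

  h2 : ∀ {Γ α β γ} → Der Ax (γ ∷ β ∷ α ∷ Γ) α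
  h2 = hyp (there (there (here refl)))

  h3 : ∀ {Γ α β γ δ} → Der Ax (δ ∷ γ ∷ β ∷ α ∷ Γ) α
  h3 = hyp (there (there (there (here refl))))

  wk1 : ∀ {Γ φ ψ} → Der Ax Γ φ → Der Ax (ψ ∷ Γ) φ
  wk1 = weaken there

  app₁ : ∀ {Γ φ ψ} → Der Ax [] (φ ⇒ ψ) → Der Ax Γ φ → Der Ax Γ ψ
  app₁ d = ⇒E (thm d)

  ∀out : ∀ {Γ} φ → Der Ax Γ (shift (∀' φ)) → Der Ax Γ φ
  ∀out φ d = cast (lift-wk-sub0 φ) (∀E d (var 0))

  ∃in : ∀ {Γ} φ → Der Ax Γ φ → Der Ax Γ (shift (∃' φ))
  ∃in φ d = ∃I (var 0) (cast (sym (lift-wk-sub0 φ)) d)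

  -- An empty context survives the shift by `wk`, after which `var 0` is fresh and can serve as the
  -- instance.
  ∀-strip : ∀ {φ} → Der Ax [] (∀' φ) → Der Ax [] φ
  ∀-strip {φ} d = ∀out φ (substDer wk d)

  ⇒-trans : ∀ {φ ψ χ} → Der Ax [] (φ ⇒ ψ) → Der Ax [] (ψ ⇒ χ) → Der Ax [] (φ ⇒ χ)
  ⇒-trans d e = ⇒I (app₁ e (app₁ d h0))

  ∧-mono : ∀ {φ φ′ ψ ψ′} → Der Ax [] (φ ⇒ φ′) → Der Ax [] (ψ ⇒ ψ′) → Der Ax [] (φ ∧' ψ ⇒ φ′ ∧' ψ′)
  ∧-mono d e = ⇒I (∧I (app₁ d (∧E₁ h0)) (app₁ e (∧E₂ h0)))

  ∨-mono : ∀ {φ φ′ ψ ψ′} → Der Ax [] (φ ⇒ φ′) → Der Ax [] (ψ ⇒ ψ′) → Der Ax [] (φ ∨' ψ ⇒ φ′ ∨' ψ′)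
  ∨-mono d e = ⇒I (∨E h0 (∨I₁ (app₁ d h0)) (∨I₂ (app₁ e h0)))

  ¬-mono : ∀ {φ ψ} → Der Ax [] (φ ⇒ ψ) → Der Ax [] (¬' ψ ⇒ ¬' φ)
  ¬-mono d = ⇒I (⇒I (⇒E h1 (app₁ d h0)))

  ∀-mono : ∀ {φ ψ} → Der Ax [] (φ ⇒ ψ) → Der Ax [] (∀' φ ⇒ ∀' ψ)
  ∀-mono {φ} d = ⇒I (∀I (app₁ d (∀out φ h0)))

  ∃-mono : ∀ {φ ψ} → Der Ax [] (φ ⇒ ψ) → Der Ax [] (∃' φ ⇒ ∃' ψ)
  ∃-mono {φ} {ψ} d = ⇒I (∃E h0 (∃in ψ (app₁ d h0)))

  ∃¬⇒¬∀ : ∀ φ → Der Ax [] (∃' (¬' φ) ⇒ ¬' (∀' φ))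
  ∃¬⇒¬∀ φ = ⇒I (⇒I (∃E h1 (⇒E h0 (∀out φ h1))))

  Dec : Formula → Set
  Dec φ = Der Ax [] (φ ∨' ¬' φ)

  decide : ∀ {Γ φ χ} → Dec φ → Der Ax (φ ∷ Γ) χ → Der Ax (¬' φ ∷ Γ) χ → Der Ax Γ χ
  decide d = ∨E (thm d)

  Dec-stable : ∀ {Γ φ} → Dec φ → Der Ax Γ (¬' (¬' φ)) → Der Ax Γ φ
  Dec-stable d e = decide d h0 (⊥E (⇒E (wk1 e) h0))

  Dec-⊥ : Dec ⊥'
  Dec-⊥ = ∨I₂ (⇒I h0)

  Dec-∧ : ∀ {φ ψ} → Dec φ → Dec ψ → Dec (φ ∧' ψ)
  Dec-∧ d e = decide d (decide e (∨I₁ (∧I h1 h0)) (∨I₂ (⇒I (⇒E h1 (∧E₂ h0))))) (∨I₂ (⇒I (⇒E h1 (∧E₁ h0))))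

  Dec-∨ : ∀ {φ ψ} → Dec φ → Dec ψ → Dec (φ ∨' ψ)
  Dec-∨ d e = decide d (∨I₁ (∨I₁ h0)) (decide e (∨I₁ (∨I₂ h0)) (∨I₂ (⇒I (∨E h0 (⇒E h3 h0) (⇒E h2 h0)))))

  Dec-⇒ : ∀ {φ ψ} → Dec φ → Dec ψ → Dec (φ ⇒ ψ)
  Dec-⇒ d e = decide d (decide e (∨I₁ (⇒I h1)) (∨I₂ (⇒I (⇒E h1 (⇒E h0 h2))))) (∨I₁ (⇒I (⊥E (⇒E h1 h0))))

  Dec-∀ : ∀ {φ} → Dec φ → Dec (∃' (¬' φ)) → Dec (∀' φ)
  Dec-∀ {φ} d e = decide e
    (∨I₂ (app₁ (∃¬⇒¬∀ φ) h0))
    (∨I₁ (∀I (decide d h0 (⊥E (⇒E h1 (∃in (¬' φ) h0))))))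

  infix 3 _⟺_
  _⟺_ : Formula → Formula → Set
  φ ⟺ ψ = Der Ax [] (φ ⇒ ψ) × Der Ax [] (ψ ⇒ φ)

  ⟺-refl : ∀ {φ} → φ ⟺ φ
  ⟺-refl = ⇒I h0 , ⇒I h0

  ⟺-sym : ∀ {φ ψ} → φ ⟺ ψ → ψ ⟺ φ
  ⟺-sym (d , e) = e , d

  ⟺-trans : ∀ {φ ψ χ} → φ ⟺ ψ → ψ ⟺ χ → φ ⟺ χ
  ⟺-trans (d , e) (d′ , e′) = ⇒-trans d d′ , ⇒-trans e′ e

  ∧-cong : ∀ {φ φ′ ψ ψ′} → φ ⟺ φ′ → ψ ⟺ ψ′ → (φ ∧' ψ) ⟺ (φ′ ∧' ψ′)
  ∧-cong (d , e) (d′ , e′) = ∧-mono d d′ , ∧-mono e e′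

  ∨-cong : ∀ {φ φ′ ψ ψ′} → φ ⟺ φ′ → ψ ⟺ ψ′ → (φ ∨' ψ) ⟺ (φ′ ∨' ψ′)
  ∨-cong (d , e) (d′ , e′) = ∨-mono d d′ , ∨-mono e e′

  ¬-cong : ∀ {φ ψ} → φ ⟺ ψ → ¬' φ ⟺ ¬' ψ
  ¬-cong (d , e) = ¬-mono e , ¬-mono d

  ∀-cong : ∀ {φ ψ} → φ ⟺ ψ → ∀' φ ⟺ ∀' ψ
  ∀-cong (d , e) = ∀-mono d , ∀-mono e

  ∃-cong : ∀ {φ ψ} → φ ⟺ ψ → ∃' φ ⟺ ∃' ψ
  ∃-cong (d , e) = ∃-mono d , ∃-mono e

  Dec-cong : ∀ {φ ψ} → φ ⟺ ψ → Dec φ → Dec ψ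
  Dec-cong (d , e) f = app₁ (∨-mono d (¬-mono e)) f

  ∧-comm : ∀ {φ ψ} → (φ ∧' ψ) ⟺ (ψ ∧' φ)
  ∧-comm = swap , swap
    where
    swap : ∀ {φ ψ} → Der Ax [] (φ ∧' ψ ⇒ ψ ∧' φ)
    swap = ⇒I (∧I (∧E₂ h0) (∧E₁ h0))

  ∃-∧ : ∀ {φ ψ} → (∃' φ ∧' ψ) ⟺ ∃' (φ ∧' shift ψ)
  ∃-∧ {φ} {ψ} = ⇒I (∃E (∧E₁ h0) (∃in (φ ∧' shift ψ) (∧I h0 (∧E₂ h1))))
              , ⇒I (∧I (∃E h0 (∃in φ (∧E₁ h0))) (∃E h0 (∧E₂ h0)))

  ∀-∧ : ∀ {φ ψ} → (∀' φ ∧' ψ) ⟺ ∀' (φ ∧' shift ψ)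
  ∀-∧ {φ} {ψ} = ⇒I (∀I (∧I (∀out φ (∧E₁ h0)) (∧E₂ h0)))
              , ⇒I (∧I (∀I (∧E₁ (∀out (φ ∧' shift ψ) h0)))
                       -- The shifted conjunct ignores the bound variable, so any term would serve
                       -- as the instance.
                       (cast (shift-sub0 ψ zeroT) (∧E₂ (∀E h0 zeroT))))

  ∀-∧-∀ : ∀ {φ ψ} → ∀' (φ ∧' ψ) ⟺ (∀' φ ∧' ∀' ψ)
  ∀-∧-∀ {φ} {ψ} = ⇒I (∧I (∀I (∧E₁ (∀out (φ ∧' ψ) h0))) (∀I (∧E₂ (∀out (φ ∧' ψ) h0))))
                , ⇒I (∀I (∧I (∀out φ (∧E₁ h0)) (∀out ψ (∧E₂ h0))))

  ∨-distrib-∧ˡ : ∀ {φ ψ χ} → (χ ∨' (φ ∧' ψ)) ⟺ ((χ ∨' φ) ∧' (χ ∨' ψ))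
  ∨-distrib-∧ˡ = ⇒I (∨E h0 (∧I (∨I₁ h0) (∨I₁ h0)) (∧I (∨I₂ (∧E₁ h0)) (∨I₂ (∧E₂ h0))))
               , ⇒I (∨E (∧E₁ h0) (∨I₁ h0) (∨E (∧E₂ h1) (∨I₁ h0) (∨I₂ (∧I h1 h0))))

  ∨-distrib-∧ʳ : ∀ {φ ψ χ} → ((φ ∧' ψ) ∨' χ) ⟺ ((φ ∨' χ) ∧' (ψ ∨' χ))
  ∨-distrib-∧ʳ = ⇒I (∨E h0 (∧I (∨I₁ (∧E₁ h0)) (∨I₁ (∧E₂ h0))) (∧I (∨I₂ h0) (∨I₂ h0)))
               , ⇒I (∨E (∧E₁ h0) (∨E (∧E₂ h1) (∨I₁ (∧I h1 h0)) (∨I₂ h0)) (∨I₂ h0))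

  ¬∃-∀¬ : ∀ {φ} → ¬' (∃' φ) ⟺ ∀' (¬' φ)
  ¬∃-∀¬ {φ} = ⇒I (∀I (⇒I (⇒E h1 (∃in φ h0))))
            , ⇒I (⇒I (∃E h0 (⇒E (∀out (¬' φ) h2) h0)))

  ¬∀-∃¬ : ∀ {φ} → Dec φ → Dec (∃' (¬' φ)) → ¬' (∀' φ) ⟺ ∃' (¬' φ)
  ¬∀-∃¬ {φ} d e = ⇒I (decide e h0 (⊥E (⇒E h1 (∀I (decide d h0 (⊥E (⇒E h1 (∃in (¬' φ) h0)))))))) , ∃¬⇒¬∀ φ

  deMorgan-∨ : ∀ {φ ψ} → Dec φ → Dec ψ → (φ ∨' ψ) ⟺ ¬' (¬' φ ∧' ¬' ψ)
  deMorgan-∨ d e = ⇒I (⇒I (∨E h1 (⇒E (∧E₁ h1) h0) (⇒E (∧E₂ h1) h0)))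
                 , ⇒I (decide d (∨I₁ h0) (decide e (∨I₂ h0) (⊥E (⇒E h2 (∧I h1 h0)))))

  ⇒-as-∨ : ∀ {φ ψ} → Dec φ → (φ ⇒ ψ) ⟺ (¬' φ ∨' ψ)
  ⇒-as-∨ d = ⇒I (decide d (∨I₂ (⇒E h1 h0)) (∨I₁ h0))
           , ⇒I (⇒I (∨E h1 (⊥E (⇒E h0 h1)) h0))

-- Decidability of equality in HA

Axioms : Theory → Formula → Set
Axioms T ψ = HAAx ψ ⊎ T ψ

module _ {T : Theory} where

  private
    Ax : Formula → Set
    Ax = Axioms T

  ≐-refl : ∀ {Γ} t → Der Ax Γ (t ≐ t)
  ≐-refl t = ax (inj₁ eq-refl) (λ _ → t)

  -- `σL₀` and `σL₁` rename a parameter `var 1` or keep `var 0` of the Leibniz formula, so such a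
  -- parameter ends up as variable 2. The default value `t` fills it, which makes the second premise
  -- an instance of reflexivity.
  leibnizAt : Term → Term → Subst
  leibnizAt t s 1 = s
  leibnizAt t s _ = t

  ≐-sym : ∀ {Γ t s} → Der Ax Γ (t ≐ s) → Der Ax Γ (s ≐ t)
  ≐-sym {t = t} {s} d = ⇒E (⇒E (ax (inj₁ (leibniz (var 0 ≐ var 1))) (leibnizAt t s)) d) (≐-refl t)

  ≐-succ : ∀ {Γ t s} → Der Ax Γ (t ≐ s) → Der Ax Γ (succT t ≐ succT s)
  ≐-succ {t = t} {s} d =
    ⇒E (⇒E (ax (inj₁ (leibniz (succT (var 1) ≐ succT (var 0)))) (leibnizAt t s)) d) (≐-refl (succT t))

  succ≢0 : ∀ {Γ} t → Der Ax Γ (¬' (succT t ≐ zeroT))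
  succ≢0 t = ax (inj₁ succ-ne0) (λ _ → t)

  succ-injective : ∀ {Γ} t s → Der Ax Γ (succT t ≐ succT s ⇒ t ≐ s)
  succ-injective t s = ax (inj₁ succ-inj) (leibnizAt t s)

  ind : ∀ {Γ} φ → Der Ax Γ (φ [ zeroT ]₀) → Der Ax (φ ∷ shiftCtx Γ) (subst σS φ) → Der Ax Γ (∀' φ)
  ind φ d e = ⇒E (⇒E (axiom (inj₁ (induction φ))) d) (∀I (⇒I e))

  ≐-dec-∀ : Der Ax [] (∀' (∀' (var 1 ≐ var 0 ∨' ¬' (var 1 ≐ var 0))))
  ≐-dec-∀ = ind _ base step
    -- Double induction: the outer one is on `var 1`, keeping the other variable quantified, and the
    -- inner one on `var 0`. For two successors the outer hypothesis is taken at the predecessor of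
    -- the second number.
    where
    decEq : Term → Term → Formula
    decEq t s = t ≐ s ∨' ¬' (t ≐ s)

    base : Der Ax [] (∀' (decEq zeroT (var 0)))
    base = ind _ (∨I₁ (≐-refl zeroT)) (∨I₂ (⇒I (⇒E (succ≢0 (var 0)) (≐-sym h0))))

    step : Der Ax (∀' (decEq (var 1) (var 0)) ∷ []) (∀' (decEq (succT (var 1)) (var 0)))
    step = ind _ (∨I₂ (succ≢0 (var 0)))
      (∨E (∀out (decEq (var 1) (var 0)) h1)
          (∨I₁ (≐-succ h0))
          (∨I₂ (⇒I (⇒E h1 (⇒E (succ-injective (var 1) (var 0)) h0)))))

  Dec-≐ : ∀ t s → Dec {Ax} (t ≐ s)
  -- In the stripped formula the left-hand side is variable 1, hence the swapped arguments.
  Dec-≐ t s = substDer (leibnizAt s t) (∀-strip (∀-strip ≐-dec-∀))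

  QF-Dec : ∀ {φ} → QF φ → Dec {Ax} φ
  QF-Dec (qf-eq {t} {s}) = Dec-≐ t s
  QF-Dec qf-⊥       = Dec-⊥
  QF-Dec (qf-∧ a b) = Dec-∧ (QF-Dec a) (QF-Dec b)
  QF-Dec (qf-∨ a b) = Dec-∨ (QF-Dec a) (QF-Dec b)
  QF-Dec (qf-⇒ a b) = Dec-⇒ (QF-Dec a) (QF-Dec b)

-- The Gödel–Gentzen translation

-- Atoms carry no double negation: equality is decidable, so they are stable already.
N : Formula → Formula
N (t ≐ s)  = t ≐ s
N ⊥'       = ⊥'
N (φ ∧' ψ) = N φ ∧' N ψ
N (φ ∨' ψ) = ¬' (¬' (N φ ∨' N ψ))
N (φ ⇒ ψ)  = N φ ⇒ N ψ
N (∀' φ)   = ∀' (N φ)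
N (∃' φ)   = ¬' (¬' (∃' (N φ)))

N-subst : ∀ σ φ → N (subst σ φ) ≡ subst σ (N φ)
N-subst σ (t ≐ s)  = refl
N-subst σ ⊥'       = refl
N-subst σ (φ ∧' ψ) = cong₂ _∧'_ (N-subst σ φ) (N-subst σ ψ)
N-subst σ (φ ∨' ψ) = cong₂ (λ α β → ¬' (¬' (α ∨' β))) (N-subst σ φ) (N-subst σ ψ)
N-subst σ (φ ⇒ ψ)  = cong₂ _⇒_ (N-subst σ φ) (N-subst σ ψ)
N-subst σ (∀' φ)   = cong ∀' (N-subst (lift σ) φ)
N-subst σ (∃' φ)   = cong (λ α → ¬' (¬' (∃' α))) (N-subst (lift σ) φ)

N-shiftCtx : ∀ Γ → map N (shiftCtx Γ) ≡ shiftCtx (map N Γ)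
N-shiftCtx Γ = trans (sym (map-∘ Γ)) (trans (map-cong (N-subst wk) Γ) (map-∘ Γ))

module _ {T : Theory} where

  private
    Ax : Formula → Set
    Ax = Axioms T

  N-stable : ∀ {Γ} φ → Der Ax Γ (¬' (¬' (N φ))) → Der Ax Γ (N φ)
  N-stable (t ≐ s)  d = Dec-stable (Dec-≐ t s) d
  N-stable ⊥'       d = ⇒E d (⇒I h0)
  N-stable (φ ∧' ψ) d = ∧I (N-stable φ (⇒I (⇒E (wk1 d) (⇒I (⇒E h1 (∧E₁ h0))))))
                           (N-stable ψ (⇒I (⇒E (wk1 d) (⇒I (⇒E h1 (∧E₂ h0))))))
  N-stable (φ ∨' ψ) d = ⇒I (⇒E (wk1 d) (⇒I (⇒E h0 h1)))
  N-stable (φ ⇒ ψ)  d = ⇒I (N-stable ψ (⇒I (⇒E (wk1 (wk1 d)) (⇒I (⇒E h1 (⇒E h0 h2))))))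
  -- The cut makes `d` a hypothesis, which `∀I` then shifts along with the context.
  N-stable (∀' φ)   d = ⇒E (⇒I (∀I (N-stable φ (⇒I (⇒E h1 (⇒I (⇒E h1 (∀out (N φ) h0)))))))) d
  N-stable (∃' φ)   d = ⇒I (⇒E (wk1 d) (⇒I (⇒E h0 h1)))

  private
    wk₂ : ∀ {α β γ : Formula} {Δ} → α ∷ Δ ⊆ α ∷ β ∷ γ ∷ Δ
    wk₂ (here p)  = here p
    wk₂ (there p) = there (there (there p))

  -- Eliminations of disjunctions and existentials meet a doubly negated premise; `N-stable` lets
  -- the conclusion be proved under a double negation, where the premise can be opened.
  translate : ∀ {Ax′ Γ φ} → (∀ {ψ} → Ax′ ψ → Der Ax [] (N ψ)) → Der Ax′ Γ φ → Der Ax (map N Γ) (N φ)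
  translate f (hyp p)     = hyp (∈-map⁺ N p)
  translate f (ax {φ = φ} a σ) = thm (cast (sym (N-subst σ φ)) (substDer σ (f a)))
  translate f (⊥E d)      = ⊥E (translate f d)
  translate f (∧I d e)    = ∧I (translate f d) (translate f e)
  translate f (∧E₁ d)     = ∧E₁ (translate f d)
  translate f (∧E₂ d)     = ∧E₂ (translate f d)
  translate f (∨I₁ d)     = ⇒I (⇒E h0 (∨I₁ (wk1 (translate f d))))
  translate f (∨I₂ d)     = ⇒I (⇒E h0 (∨I₂ (wk1 (translate f d))))
  translate f (∨E {χ = χ} d e g) =
    N-stable χ (⇒I (⇒E (wk1 (translate f d))
      (⇒I (⇒E h1 (∨E h0 (weaken wk₂ (translate f e)) (weaken wk₂ (translate f g)))))))
  translate f (⇒I d)      = ⇒I (translate f d)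
  translate f (⇒E d e)    = ⇒E (translate f d) (translate f e)
  translate f (∀I {Γ} d)  = ∀I (Der-cong (N-shiftCtx Γ) refl (translate f d))
  translate f (∀E {φ = φ} d t) = cast (sym (N-subst (sub0 t) φ)) (∀E (translate f d) t)
  translate f (∃I {φ = φ} t d) = ⇒I (⇒E h0 (∃I t (wk1 (cast (N-subst (sub0 t) φ) (translate f d)))))
  translate f (∃E {Γ} {φ} {ψ} d e) =
    N-stable ψ (⇒I (⇒E (wk1 (translate f d))
      (⇒I (⇒E h1 (∃E h0 (weaken wk₂ e′))))))
    where
    e′ : Der Ax (N φ ∷ shiftCtx (map N Γ)) (shift (N ψ))
    e′ = Der-cong (cong (N φ ∷_) (N-shiftCtx Γ)) (N-subst wk ψ) (translate f e)

  -- The two schemata go to their own instances at `N φ`, because `N` commutes with substitution;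
  -- the remaining axioms are fixed by `N`.
  HAAx-N : ∀ {φ} → HAAx φ → Der Ax [] (N φ)
  HAAx-N a@eq-refl        = axiom (inj₁ a)
  HAAx-N (leibniz φ)      = cast (cong₂ (λ α β → var 0 ≐ var 1 ⇒ α ⇒ β)
                              (sym (N-subst σL₀ φ)) (sym (N-subst σL₁ φ))) (axiom (inj₁ (leibniz (N φ))))
  HAAx-N a@succ-ne0       = axiom (inj₁ a)
  HAAx-N a@succ-inj       = axiom (inj₁ a)
  HAAx-N a@(def-proj _)   = axiom (inj₁ a)
  HAAx-N a@(def-comp _ _) = axiom (inj₁ a)
  HAAx-N a@(def-rec0 _ _) = axiom (inj₁ a)
  HAAx-N a@(def-recS _ _) = axiom (inj₁ a)
  HAAx-N (induction φ)    = cast (cong₂ (λ α β → α ⇒ ∀' (N φ ⇒ β) ⇒ ∀' (N φ))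
                              (sym (N-subst (sub0 zeroT) φ)) (sym (N-subst σS φ))) (axiom (inj₁ (induction (N φ))))

  LEM-N : ∀ {φ} → LEM φ → Der Ax [] (N φ)
  LEM-N (lem φ) = ⇒I (⇒E h0 (∨I₂ (⇒I (⇒E h1 (∨I₁ h0)))))

-- Alternation paths

length≤cons : ∀ a s → length s ≤ length (cons a s)
length≤cons plus  []          = z≤n
length≤cons plus  (plus ∷ s)  = ≤-refl
length≤cons plus  (minus ∷ s) = n≤1+n _
length≤cons minus []          = z≤n
length≤cons minus (plus ∷ s)  = n≤1+n _
length≤cons minus (minus ∷ s) = ≤-refl

cons≤suc-length : ∀ a s → length (cons a s) ≤ suc (length s)
cons≤suc-length plus  []          = ≤-refl
cons≤suc-length plus  (plus ∷ s)  = n≤1+n _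
cons≤suc-length plus  (minus ∷ s) = ≤-refl
cons≤suc-length minus []          = ≤-refl
cons≤suc-length minus (plus ∷ s)  = ≤-refl
cons≤suc-length minus (minus ∷ s) = n≤1+n _

cons-idem : ∀ a s → cons a (cons a s) ≡ cons a s
cons-idem plus  []          = refl
cons-idem plus  (plus ∷ s)  = refl
cons-idem plus  (minus ∷ s) = refl
cons-idem minus []          = refl
cons-idem minus (plus ∷ s)  = refl
cons-idem minus (minus ∷ s) = refl

cons-flip : ∀ a s → length (cons a (cons (flipS a) s)) ≡ suc (length (cons (flipS a) s))
cons-flip plus  []          = refl
cons-flip plus  (plus ∷ s)  = refl
cons-flip plus  (minus ∷ s) = refl
cons-flip minus []          = refl
cons-flip minus (plus ∷ s)  = refl
cons-flip minus (minus ∷ s) = refl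

length-⊥ₛ : ∀ s → length (s ⊥ₛ) ≡ length s
length-⊥ₛ []      = refl
length-⊥ₛ (_ ∷ s) = cong suc (length-⊥ₛ s)

-- The reason why an antecedent is measured against the opposite quantifier in `Led-⇒ˡ`.
cons-⊥ₛ : ∀ a s → length (cons a (s ⊥ₛ)) ≡ length (cons (flipS a) s)
cons-⊥ₛ plus  []          = refl
cons-⊥ₛ plus  (plus ∷ s)  = cong (suc ∘ suc) (length-⊥ₛ s)
cons-⊥ₛ plus  (minus ∷ s) = cong suc (length-⊥ₛ s)
cons-⊥ₛ minus []          = refl
cons-⊥ₛ minus (plus ∷ s)  = cong suc (length-⊥ₛ s)
cons-⊥ₛ minus (minus ∷ s) = cong (suc ∘ suc) (length-⊥ₛ s)

isQF⇒QF : ∀ φ → isQF φ ≡ true → QF φ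
isQF⇒QF (t ≐ s)  _ = qf-eq
isQF⇒QF ⊥'       _ = qf-⊥
isQF⇒QF (φ ∧' ψ) e with isQF φ in p | isQF ψ in q
... | true | true = qf-∧ (isQF⇒QF φ p) (isQF⇒QF ψ q)
isQF⇒QF (φ ∨' ψ) e with isQF φ in p | isQF ψ in q
... | true | true = qf-∨ (isQF⇒QF φ p) (isQF⇒QF ψ q)
isQF⇒QF (φ ⇒ ψ)  e with isQF φ in p | isQF ψ in q
... | true | true = qf-⇒ (isQF⇒QF φ p) (isQF⇒QF ψ q)

-- `Alt` of a compound is a concatenation only if the compound contains a quantifier; otherwise it
-- collapses to the empty path alone. The case split on `isQF` here and below reconciles the two.
Alt-∧ˡ : ∀ φ ψ {s} → s ∈ Alt φ → s ∈ Alt (φ ∧' ψ)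
Alt-∧ˡ φ ψ p with isQF φ | isQF ψ
... | true  | true  = p
... | true  | false = ∈-++⁺ˡ p
... | false | _     = ∈-++⁺ˡ p

Alt-∧ʳ : ∀ φ ψ {s} → s ∈ Alt ψ → s ∈ Alt (φ ∧' ψ)
Alt-∧ʳ φ ψ p with isQF φ | isQF ψ
... | true  | true  = p
... | true  | false = there p
... | false | _     = ∈-++⁺ʳ _ p

Alt-∨ˡ : ∀ φ ψ {s} → s ∈ Alt φ → s ∈ Alt (φ ∨' ψ)
Alt-∨ˡ φ ψ p with isQF φ | isQF ψ
... | true  | true  = p
... | true  | false = ∈-++⁺ˡ p
... | false | _     = ∈-++⁺ˡ p

Alt-∨ʳ : ∀ φ ψ {s} → s ∈ Alt ψ → s ∈ Alt (φ ∨' ψ)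
Alt-∨ʳ φ ψ p with isQF φ | isQF ψ
... | true  | true  = p
... | true  | false = there p
... | false | _     = ∈-++⁺ʳ _ p

Alt-⇒ˡ : ∀ φ ψ {s} → s ∈ Alt φ → (s ⊥ₛ) ∈ Alt (φ ⇒ ψ)
Alt-⇒ˡ φ ψ p with isQF φ | isQF ψ
... | true  | true  = ∈-map⁺ _⊥ₛ p
... | true  | false = ∈-++⁺ˡ (∈-map⁺ _⊥ₛ p)
... | false | _     = ∈-++⁺ˡ (∈-map⁺ _⊥ₛ p)

Alt-⇒ʳ : ∀ φ ψ {s} → s ∈ Alt ψ → s ∈ Alt (φ ⇒ ψ)
Alt-⇒ʳ φ ψ p with isQF φ | isQF ψ
... | true  | true  = p
... | true  | false = there p
... | false | _     = ∈-++⁺ʳ _ p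

Alt-∧⁻ : ∀ φ ψ {s} → s ∈ Alt (φ ∧' ψ) → s ∈ Alt φ ⊎ s ∈ Alt ψ
Alt-∧⁻ φ ψ p with isQF φ | isQF ψ
... | true  | true  = inj₁ p
... | true  | false = ∈-++⁻ ([ [] ]) p
... | false | _     = ∈-++⁻ _ p

Alt-∨⁻ : ∀ φ ψ {s} → s ∈ Alt (φ ∨' ψ) → s ∈ Alt φ ⊎ s ∈ Alt ψ
Alt-∨⁻ φ ψ p with isQF φ | isQF ψ
... | true  | true  = inj₁ p
... | true  | false = ∈-++⁻ ([ [] ]) p
... | false | _     = ∈-++⁻ _ p

QF⇒isQF : ∀ {φ} → QF φ → isQF φ ≡ true
QF⇒isQF qf-eq      = refl
QF⇒isQF qf-⊥       = refl
QF⇒isQF (qf-∧ a b) rewrite QF⇒isQF a | QF⇒isQF b = refl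
QF⇒isQF (qf-∨ a b) rewrite QF⇒isQF a | QF⇒isQF b = refl
QF⇒isQF (qf-⇒ a b) rewrite QF⇒isQF a | QF⇒isQF b = refl

QF-Alt : ∀ {φ} → QF φ → Alt φ ≡ [ [] ]
QF-Alt q rewrite QF⇒isQF q = refl

-- F k φ says deg φ ≤ k; Led a k φ says deg (Q x. φ) ≤ k for the quantifier Q of sign a.
F : ℕ → Formula → Set
F k φ = ∀ {s} → s ∈ Alt φ → length s ≤ k

Led : Sign → ℕ → Formula → Set
Led a k φ = ∀ {s} → s ∈ Alt φ → length (cons a s) ≤ k

F⇒deg≤ : ∀ {k} φ → F k φ → deg φ ≤ k
F⇒deg≤ {k} φ = go (Alt φ)
  where
  go : ∀ ss → (∀ {s} → s ∈ ss → length s ≤ k) → foldr _⊔_ 0 (map length ss) ≤ k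
  go []       f = z≤n
  go (s ∷ ss) f = ⊔-lub (f (here refl)) (go ss (f ∘ there))

length≤deg : ∀ φ → F (deg φ) φ
length≤deg φ = go (Alt φ)
  where
  go : ∀ ss {s} → s ∈ ss → length s ≤ foldr _⊔_ 0 (map length ss)
  go (s ∷ ss) (here refl) = m≤m⊔n _ _
  go (s ∷ ss) (there p)   = ≤-trans (go ss p) (m≤n⊔m (length s) _)

F⁺⇒F : ∀ {k} φ → F⁺ k φ → F k φ
F⁺⇒F φ d p = ≤-trans (length≤deg φ p) d

Led⇒F : ∀ {k} a φ → Led a k φ → F k φ
Led⇒F a φ l {s} p = ≤-trans (length≤cons a s) (l p)

F⇒Led : ∀ {k} a φ → F k φ → Led a (suc k) φ
F⇒Led a φ f {s} p = ≤-trans (cons≤suc-length a s) (s≤s (f p))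

-- Paths of full length already start with `minus` and do not grow under `cons minus`; shorter ones
-- have room for one more sign.
U⇒Led : ∀ {k} φ → U k φ → Led minus (suc k) φ
U⇒Led {k} φ (d , m) {s} p = go s (F⁺⇒F φ (≤-reflexive d) p) (m s p)
  where
  go : ∀ s → length s ≤ suc k → (length s ≡ suc k → i s ≡ ini minus) → length (cons minus s) ≤ suc k
  go []          l m = s≤s z≤n
  go (minus ∷ s) l m = l
  go (plus ∷ s)  (s≤s l) m with m≤n⇒m<n∨m≡n l
  ... | inj₁ q = s≤s q
  ... | inj₂ q with () ← m (cong suc q)

-- A path of full length starting with `plus` would become too long under `cons minus`. The lower
-- bound makes the degree exact.
Led⇒U : ∀ {k} φ → Led minus (suc k) φ → suc k ≤ deg φ → U k φ
Led⇒U {k} φ l d = ≤-antisym (F⇒deg≤ φ (Led⇒F minus φ l)) d , λ s p e → go s e (l p)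
  where
  go : ∀ s → length s ≡ suc k → length (cons minus s) ≤ suc k → i s ≡ ini minus
  go (minus ∷ s) e q = refl
  go (plus ∷ s)  e q rewrite e = ⊥-elim (1+n≰n q)

Led-∧ : ∀ {k} a φ ψ → Led a k φ → Led a k ψ → Led a k (φ ∧' ψ)
Led-∧ a φ ψ l m p with Alt-∧⁻ φ ψ p
... | inj₁ q = l q
... | inj₂ q = m q

Led-∨ : ∀ {k} a φ ψ → Led a k φ → Led a k ψ → Led a k (φ ∨' ψ)
Led-∨ a φ ψ l m p with Alt-∨⁻ φ ψ p
... | inj₁ q = l q
... | inj₂ q = m q

Led-∀ : ∀ {k} φ → Led minus k φ → Led minus k (∀' φ)
Led-∀ φ l p with ∈-map⁻ (cons minus) p
... | s , q , refl = ≤-trans (≤-reflexive (cong length (cons-idem minus s))) (l q)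

Led-∃ : ∀ {k} φ → Led plus k φ → Led plus k (∃' φ)
Led-∃ φ l p with ∈-map⁻ (cons plus) p
... | s , q , refl = ≤-trans (≤-reflexive (cong length (cons-idem plus s))) (l q)

-- Degrees of the arithmetical classes and padding

mutual
  Σ⇒F : ∀ {k φ} → Σₖ k φ → F k φ
  Σ⇒F (Σ-qf q) p rewrite QF-Alt q with here refl ← p = z≤n
  Σ⇒F {suc k} {φ} s = Led⇒F plus φ (Σ⇒Led s)

  Π⇒F : ∀ {k φ} → Πₖ k φ → F k φ
  Π⇒F (Π-qf q) p rewrite QF-Alt q with here refl ← p = z≤n
  Π⇒F {suc k} {φ} s = Led⇒F minus φ (Π⇒Led s)

  Σ⇒Led : ∀ {k φ} → Σₖ (suc k) φ → Led plus (suc k) φ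
  Σ⇒Led {φ = φ} (Σ-Π p) = F⇒Led plus φ (Π⇒F p)
  Σ⇒Led (Σ-∃ {φ = φ} p) = Led-∃ φ (Σ⇒Led p)

  Π⇒Led : ∀ {k φ} → Πₖ (suc k) φ → Led minus (suc k) φ
  Π⇒Led {φ = φ} (Π-Σ p) = F⇒Led minus φ (Σ⇒F p)
  Π⇒Led (Π-∀ {φ = φ} p) = Led-∀ φ (Π⇒Led p)

EΠ⇒Led : ∀ {k φ} → EΠ (suc k) φ → Led minus (suc k) φ
EΠ⇒Led (eπ-base p) = Π⇒Led p
EΠ⇒Led (eπ-∨ {φ} {ψ} p q) = Led-∨ minus φ ψ (EΠ⇒Led p) (EΠ⇒Led q)
EΠ⇒Led (eπ-∀ {φ} p) = Led-∀ φ (EΠ⇒Led p)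

-- Provable, and of degree exactly k: conjoining pad minus (suc k) turns any
-- formula of EΠ_{k+1} into an equivalent one of U_{k+1}.
pad : Sign → ℕ → Formula
pad a     zero    = zeroT ≐ zeroT
pad plus  (suc k) = ∃' (pad minus k)
pad minus (suc k) = ∀' (pad plus k)

path : Sign → ℕ → AltPath
path a zero    = []
path a (suc k) = a ∷ path (flipS a) k

cons-path : ∀ a k → cons a (path (flipS a) k) ≡ a ∷ path (flipS a) k
cons-path plus  zero    = refl
cons-path plus  (suc k) = refl
cons-path minus zero    = refl
cons-path minus (suc k) = refl

length-path : ∀ a k → length (path a k) ≡ k
length-path a zero    = refl
length-path a (suc k) = cong suc (length-path (flipS a) k)

path∈Alt-pad : ∀ a k → path a k ∈ Alt (pad a k)
path∈Alt-pad plus  zero    = here refl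
path∈Alt-pad minus zero    = here refl
path∈Alt-pad plus  (suc k) = ≡.subst (_∈ Alt (pad plus (suc k))) (cons-path plus k) (∈-map⁺ (cons plus) (path∈Alt-pad minus k))
path∈Alt-pad minus (suc k) = ≡.subst (_∈ Alt (pad minus (suc k))) (cons-path minus k) (∈-map⁺ (cons minus) (path∈Alt-pad plus k))

pad-Σ : ∀ k → Σₖ k (pad plus k)
pad-Π : ∀ k → Πₖ k (pad minus k)
pad-Σ zero    = Σ-qf qf-eq
pad-Σ (suc k) = Σ-∃ (Σ-Π (pad-Π k))
pad-Π zero    = Π-qf qf-eq
pad-Π (suc k) = Π-∀ (Π-Σ (pad-Σ k))

pad-provable : ∀ {T} a k → T ⊢ pad a k
pad-provable a     zero    = ≐-refl zeroT
pad-provable plus  (suc k) = ∃I zeroT (substDer (sub0 zeroT) (pad-provable minus k))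
pad-provable minus (suc k) = ∀I (pad-provable plus k)

padded-U : ∀ {k φ} → EΠ (suc k) φ → U k (pad minus (suc k) ∧' φ)
padded-U {k} {φ} p = Led⇒U (P ∧' φ) (Led-∧ minus P φ (Π⇒Led (pad-Π (suc k))) (EΠ⇒Led p))
  -- The path contributed by the padding has length exactly `suc k`, so the degree is attained.
  (≤-trans (≤-reflexive (sym (length-path minus (suc k))))
           (length≤deg (P ∧' φ) (Alt-∧ˡ P φ (path∈Alt-pad minus (suc k)))))
  where P = pad minus (suc k)

-- `Led minus` survives both connectives, and the degree `suc k` is attained within `φ`.
U-∨∀ : ∀ {k} φ ψ → U k φ → U k ψ → U k (φ ∨' ∀' ψ)
U-∨∀ φ ψ u@(d , _) v = Led⇒U (φ ∨' ∀' ψ) (Led-∨ minus φ (∀' ψ) (U⇒Led φ u) (Led-∀ ψ (U⇒Led ψ v)))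
  (≡.subst (_≤ deg (φ ∨' ∀' ψ)) d (F⇒deg≤ φ (λ p → length≤deg (φ ∨' ∀' ψ) (Alt-∨ˡ φ (∀' ψ) p))))

Alt-nonempty : ∀ φ → ∃[ s ] s ∈ Alt φ
Alt-nonempty (t ≐ s)  = [] , here refl
Alt-nonempty ⊥'       = [] , here refl
Alt-nonempty (φ ∧' ψ) = _ , Alt-∧ˡ φ ψ (proj₂ (Alt-nonempty φ))
Alt-nonempty (φ ∨' ψ) = _ , Alt-∨ˡ φ ψ (proj₂ (Alt-nonempty φ))
Alt-nonempty (φ ⇒ ψ)  = _ , Alt-⇒ʳ φ ψ (proj₂ (Alt-nonempty ψ))
Alt-nonempty (∀' φ)   = _ , ∈-map⁺ (cons minus) (proj₂ (Alt-nonempty φ))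
Alt-nonempty (∃' φ)   = _ , ∈-map⁺ (cons plus) (proj₂ (Alt-nonempty φ))

-- There is at least one path, and prefixing a sign makes it nonempty. This disposes of the
-- quantifier cases at level zero.
¬Led-0 : ∀ a φ → ¬ Led a 0 φ
¬Led-0 a φ l with Alt-nonempty φ
... | s , p = cons-positive a s (l p)
  where
  cons-positive : ∀ a s → ¬ length (cons a s) ≤ 0
  cons-positive plus  []          ()
  cons-positive plus  (plus ∷ s)  ()
  cons-positive plus  (minus ∷ s) ()
  cons-positive minus []          ()
  cons-positive minus (plus ∷ s)  ()
  cons-positive minus (minus ∷ s) ()

Led-⇒ˡ : ∀ {k} a φ ψ → Led a k (φ ⇒ ψ) → Led (flipS a) k φ
Led-⇒ˡ a φ ψ l {s} p = ≤-trans (≤-reflexive (sym (cons-⊥ₛ a s))) (l (Alt-⇒ˡ φ ψ p))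

F-⇒ˡ : ∀ {k} φ ψ → F k (φ ⇒ ψ) → F k φ
F-⇒ˡ φ ψ f {s} p = ≤-trans (≤-reflexive (sym (length-⊥ₛ s))) (f (Alt-⇒ˡ φ ψ p))

Led-∀⁻ : ∀ {k} φ → Led minus k (∀' φ) → Led minus k φ
Led-∀⁻ φ l {s} p = ≤-trans (≤-reflexive (sym (cong length (cons-idem minus s)))) (l (∈-map⁺ (cons minus) p))

Led-∃⁻ : ∀ {k} φ → Led plus k (∃' φ) → Led plus k φ
Led-∃⁻ φ l {s} p = ≤-trans (≤-reflexive (sym (cong length (cons-idem plus s)))) (l (∈-map⁺ (cons plus) p))

-- By `cons-flip` the change of quantifier uses up one alternation, whence the drop from `suc k` to
-- `k`.
Led-flip-∀⁻ : ∀ {k} φ → Led plus (suc k) (∀' φ) → Led minus k φ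
Led-flip-∀⁻ φ l {s} p with s≤s q ← ≤-trans (≤-reflexive (sym (cons-flip plus s))) (l (∈-map⁺ (cons minus) p)) = q

Led-flip-∃⁻ : ∀ {k} φ → Led minus (suc k) (∃' φ) → Led plus k φ
Led-flip-∃⁻ φ l {s} p with s≤s q ← ≤-trans (≤-reflexive (sym (cons-flip minus s))) (l (∈-map⁺ (cons plus) p)) = q

-- The arithmetical hierarchy up to provable equivalence

QF-subst : ∀ {φ} σ → QF φ → QF (subst σ φ)
QF-subst σ qf-eq      = qf-eq
QF-subst σ qf-⊥       = qf-⊥
QF-subst σ (qf-∧ a b) = qf-∧ (QF-subst σ a) (QF-subst σ b)
QF-subst σ (qf-∨ a b) = qf-∨ (QF-subst σ a) (QF-subst σ b)
QF-subst σ (qf-⇒ a b) = qf-⇒ (QF-subst σ a) (QF-subst σ b)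

mutual
  Σ-subst : ∀ {k φ} σ → Σₖ k φ → Σₖ k (subst σ φ)
  Σ-subst σ (Σ-qf q) = Σ-qf (QF-subst σ q)
  Σ-subst σ (Σ-Π p)  = Σ-Π (Π-subst σ p)
  Σ-subst σ (Σ-∃ p)  = Σ-∃ (Σ-subst (lift σ) p)

  Π-subst : ∀ {k φ} σ → Πₖ k φ → Πₖ k (subst σ φ)
  Π-subst σ (Π-qf q) = Π-qf (QF-subst σ q)
  Π-subst σ (Π-Σ p)  = Π-Σ (Σ-subst σ p)
  Π-subst σ (Π-∀ p)  = Π-∀ (Π-subst (lift σ) p)

EΠ-subst : ∀ {k φ} σ → EΠ k φ → EΠ k (subst σ φ)
EΠ-subst σ (eπ-base p) = eπ-base (Π-subst σ p)
EΠ-subst σ (eπ-∨ p q)  = eπ-∨ (EΠ-subst σ p) (EΠ-subst σ q)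
EΠ-subst σ (eπ-∀ p)    = eπ-∀ (EΠ-subst (lift σ) p)

mutual
  Σ-suc : ∀ {k φ} → Σₖ k φ → Σₖ (suc k) φ
  Σ-suc (Σ-qf q) = Σ-Π (Π-qf q)
  Σ-suc (Σ-Π p)  = Σ-Π (Π-suc p)
  Σ-suc (Σ-∃ p)  = Σ-∃ (Σ-suc p)

  Π-suc : ∀ {k φ} → Πₖ k φ → Πₖ (suc k) φ
  Π-suc (Π-qf q) = Π-Σ (Σ-qf q)
  Π-suc (Π-Σ p)  = Π-Σ (Σ-suc p)
  Π-suc (Π-∀ p)  = Π-∀ (Π-suc p)

QF⇒Σ : ∀ k {φ} → QF φ → Σₖ k φ
QF⇒Σ zero    q = Σ-qf q
QF⇒Σ (suc k) q = Σ-suc (QF⇒Σ k q)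

QF⇒Π : ∀ k {φ} → QF φ → Πₖ k φ
QF⇒Π zero    q = Π-qf q
QF⇒Π (suc k) q = Π-suc (QF⇒Π k q)

module Hierarchy (T : Theory) where

  private
    Ax : Formula → Set
    Ax = Axioms T

    infix 3 _≈_
    _≈_ : Formula → Formula → Set
    _≈_ = _⟺_ {Ax}

  -- The prenex classes are not syntactically closed under the connectives, so membership is taken
  -- up to equivalence provable in `T`.
  IsΣ IsΠ : ℕ → Formula → Set
  IsΣ k φ = ∃[ ψ ] Σₖ k ψ × (φ ≈ ψ)
  IsΠ k φ = ∃[ ψ ] Πₖ k ψ × (φ ≈ ψ)

  LEMΣ : ℕ → Set
  LEMΣ k = ∀ {φ} → Σₖ k φ → Dec {Ax} φ

  LEMΣ-pred : ∀ {k} → LEMΣ (suc k) → LEMΣ k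
  LEMΣ-pred l s = l (Σ-suc s)

  toΣ : ∀ {k φ} → Σₖ k φ → IsΣ k φ
  toΣ s = _ , s , ⟺-refl

  toΠ : ∀ {k φ} → Πₖ k φ → IsΠ k φ
  toΠ s = _ , s , ⟺-refl

  IsΣ-resp : ∀ {k φ ψ} → φ ≈ ψ → IsΣ k ψ → IsΣ k φ
  IsΣ-resp e (χ , s , f) = χ , s , ⟺-trans e f

  IsΠ-resp : ∀ {k φ ψ} → φ ≈ ψ → IsΠ k ψ → IsΠ k φ
  IsΠ-resp e (χ , s , f) = χ , s , ⟺-trans e f

  IsΠ⇒IsΣ : ∀ {k φ} → IsΠ k φ → IsΣ (suc k) φ
  IsΠ⇒IsΣ (χ , s , f) = χ , Σ-Π s , f

  IsΣ⇒IsΠ : ∀ {k φ} → IsΣ k φ → IsΠ (suc k) φ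
  IsΣ⇒IsΠ (χ , s , f) = χ , Π-Σ s , f

  IsΣ-∃ : ∀ {k φ} → IsΣ (suc k) φ → IsΣ (suc k) (∃' φ)
  IsΣ-∃ (χ , s , f) = _ , Σ-∃ s , ∃-cong f

  IsΠ-∀ : ∀ {k φ} → IsΠ (suc k) φ → IsΠ (suc k) (∀' φ)
  IsΠ-∀ (χ , s , f) = _ , Π-∀ s , ∀-cong f

  IsΣ-subst : ∀ {k φ} σ → IsΣ k φ → IsΣ k (subst σ φ)
  IsΣ-subst σ (χ , s , d , e) = _ , Σ-subst σ s , substDer σ d , substDer σ e

  -- Connectives on prenex formulas

  mutual
    -- The quantifiers of the right conjunct are pulled out first, shifting the left one; `Σ-∧-Π`
    -- then empties the leading block of the left conjunct, and the matrices meet one level below.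
    Σ-∧ : ∀ {k φ ψ} → Σₖ k φ → Σₖ k ψ → IsΣ k (φ ∧' ψ)
    Σ-∧ (Σ-qf a) (Σ-qf b) = toΣ (Σ-qf (qf-∧ a b))
    Σ-∧ a (Σ-Π b)         = Σ-∧-Π a b
    Σ-∧ a (Σ-∃ b)         = IsΣ-resp (⟺-trans ∧-comm (⟺-trans ∃-∧ (∃-cong ∧-comm)))
                                     (IsΣ-∃ (Σ-∧ (Σ-subst wk a) b))

    Σ-∧-Π : ∀ {k φ ψ} → Σₖ (suc k) φ → Πₖ k ψ → IsΣ (suc k) (φ ∧' ψ)
    Σ-∧-Π (Σ-Π a) b = IsΠ⇒IsΣ (Π-∧ a b)
    Σ-∧-Π (Σ-∃ a) b = IsΣ-resp ∃-∧ (IsΣ-∃ (Σ-∧-Π a (Π-subst wk b)))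

    Π-∧ : ∀ {k φ ψ} → Πₖ k φ → Πₖ k ψ → IsΠ k (φ ∧' ψ)
    Π-∧ (Π-qf a) (Π-qf b) = toΠ (Π-qf (qf-∧ a b))
    Π-∧ a (Π-Σ b)         = Π-∧-Σ a b
    Π-∧ a (Π-∀ b)         = IsΠ-resp (⟺-trans ∧-comm (⟺-trans ∀-∧ (∀-cong ∧-comm)))
                                     (IsΠ-∀ (Π-∧ (Π-subst wk a) b))

    Π-∧-Σ : ∀ {k φ ψ} → Πₖ (suc k) φ → Σₖ k ψ → IsΠ (suc k) (φ ∧' ψ)
    Π-∧-Σ (Π-Σ a) b = IsΣ⇒IsΠ (Σ-∧ a b)
    Π-∧-Σ (Π-∀ a) b = IsΠ-resp ∀-∧ (IsΠ-∀ (Π-∧-Σ a (Σ-subst wk b)))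

  IsΣ-∧ : ∀ {k φ ψ} → IsΣ k φ → IsΣ k ψ → IsΣ k (φ ∧' ψ)
  IsΣ-∧ (_ , a , e) (_ , b , f) = IsΣ-resp (∧-cong e f) (Σ-∧ a b)

  IsΠ-∧ : ∀ {k φ ψ} → IsΠ k φ → IsΠ k ψ → IsΠ k (φ ∧' ψ)
  IsΠ-∧ (_ , a , e) (_ , b , f) = IsΠ-resp (∧-cong e f) (Π-∧ a b)

  IsΣ-Dec : ∀ {k φ} → LEMΣ k → IsΣ k φ → Dec {Ax} φ
  IsΣ-Dec l (_ , s , e) = Dec-cong (⟺-sym e) (l s)

  mutual
    Σ-¬ : ∀ k {φ} → LEMΣ k → Σₖ k φ → IsΠ k (¬' φ)
    Σ-¬ zero    l (Σ-qf q) = toΠ (Π-qf (qf-⇒ q qf-⊥))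
    Σ-¬ (suc k) l s        = Σ-suc-¬ k (LEMΣ-pred l) s

    -- Excluded middle one level down suffices: moving a negation through the leading existential
    -- block is intuitionistic, and only the matrix in `Πₖ k` needs decidability. The induction in
    -- `CD⇒LEMΣ` depends on this gap.
    Σ-suc-¬ : ∀ k {φ} → LEMΣ k → Σₖ (suc k) φ → IsΠ (suc k) (¬' φ)
    Σ-suc-¬ k l (Σ-Π p) = IsΣ⇒IsΠ (Π-¬ k l p)
    Σ-suc-¬ k l (Σ-∃ s) = IsΠ-resp ¬∃-∀¬ (IsΠ-∀ (Σ-suc-¬ k l s))

    -- Turning a negated universal into an existential needs `∃' (¬' φ)` to be decidable; by
    -- recursion that formula is equivalent to one in `Σₖ`, where `LEMΣ` applies.
    Π-¬ : ∀ k {φ} → LEMΣ k → Πₖ k φ → IsΣ k (¬' φ)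
    Π-¬ zero    l (Π-qf q) = toΣ (Σ-qf (qf-⇒ q qf-⊥))
    Π-¬ (suc k) l (Π-Σ s)  = IsΠ⇒IsΣ (Σ-¬ k (LEMΣ-pred l) s)
    Π-¬ (suc k) l (Π-∀ p)  = IsΣ-resp (¬∀-∃¬ (Π-Dec (suc k) l p) (IsΣ-Dec l ∃¬)) ∃¬
      where ∃¬ = IsΣ-∃ (Π-¬ (suc k) l p)

    Π-Dec : ∀ k {φ} → LEMΣ k → Πₖ k φ → Dec {Ax} φ
    Π-Dec zero    l (Π-qf q) = l (Σ-qf q)
    Π-Dec (suc k) l (Π-Σ s)  = LEMΣ-pred l s
    Π-Dec (suc k) l (Π-∀ p)  = Dec-∀ (Π-Dec (suc k) l p) (IsΣ-Dec l (IsΣ-∃ (Π-¬ (suc k) l p)))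

  IsΠ-Dec : ∀ {k φ} → LEMΣ k → IsΠ k φ → Dec {Ax} φ
  IsΠ-Dec {k} l (_ , s , e) = Dec-cong (⟺-sym e) (Π-Dec k l s)

  IsΣ-¬ : ∀ {k φ} → LEMΣ k → IsΣ k φ → IsΠ k (¬' φ)
  IsΣ-¬ {k} l (_ , s , e) = IsΠ-resp (¬-cong e) (Σ-¬ k l s)

  IsΠ-¬ : ∀ {k φ} → LEMΣ k → IsΠ k φ → IsΣ k (¬' φ)
  IsΠ-¬ {k} l (_ , s , e) = IsΣ-resp (¬-cong e) (Π-¬ k l s)

  -- Universal quantifiers cannot be pulled out of a disjunction intuitionistically. Decidable
  -- disjuncts permit the detour through De Morgan, which leaves only negations and a conjunction.
  IsΣ-∨ : ∀ {k φ ψ} → LEMΣ k → IsΣ k φ → IsΣ k ψ → IsΣ k (φ ∨' ψ)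
  IsΣ-∨ l a b = IsΣ-resp (deMorgan-∨ (IsΣ-Dec l a) (IsΣ-Dec l b)) (IsΠ-¬ l (IsΠ-∧ (IsΣ-¬ l a) (IsΣ-¬ l b)))

  IsΠ-∨ : ∀ {k φ ψ} → LEMΣ k → IsΠ k φ → IsΠ k ψ → IsΠ k (φ ∨' ψ)
  IsΠ-∨ l a b = IsΠ-resp (deMorgan-∨ (IsΠ-Dec l a) (IsΠ-Dec l b)) (IsΣ-¬ l (IsΣ-∧ (IsΠ-¬ l a) (IsΠ-¬ l b)))

  -- Prenex normal forms under excluded middle

  mutual
    -- Simultaneous recursion on the formula: antecedents exchange the two classes, a quantifier of
    -- the same sign joins the leading block, and one of the opposite sign continues one level
    -- lower.
    Led⇒IsΣ : ∀ k φ → LEMΣ k → Led plus k φ → IsΣ k φ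
    Led⇒IsΣ k (t ≐ s)  l f = toΣ (QF⇒Σ k qf-eq)
    Led⇒IsΣ k ⊥'       l f = toΣ (QF⇒Σ k qf-⊥)
    Led⇒IsΣ k (φ ∧' ψ) l f = IsΣ-∧ (Led⇒IsΣ k φ l (f ∘ Alt-∧ˡ φ ψ)) (Led⇒IsΣ k ψ l (f ∘ Alt-∧ʳ φ ψ))
    Led⇒IsΣ k (φ ∨' ψ) l f = IsΣ-∨ l (Led⇒IsΣ k φ l (f ∘ Alt-∨ˡ φ ψ)) (Led⇒IsΣ k ψ l (f ∘ Alt-∨ʳ φ ψ))
    Led⇒IsΣ k (φ ⇒ ψ)  l f = IsΣ-resp (⇒-as-∨ (IsΠ-Dec l a)) (IsΣ-∨ l (IsΠ-¬ l a) (Led⇒IsΣ k ψ l (f ∘ Alt-⇒ʳ φ ψ)))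
      where a = Led⇒IsΠ k φ l (Led-⇒ˡ plus φ ψ f)
    Led⇒IsΣ zero    (∀' φ) l f = ⊥-elim (¬Led-0 plus (∀' φ) f)
    Led⇒IsΣ (suc k) (∀' φ) l f = IsΠ⇒IsΣ (∀-IsΠ k φ (LEMΣ-pred l) (Led-flip-∀⁻ φ f))
    Led⇒IsΣ k (∃' φ)   l f = ∃-IsΣ k φ l (Led-∃⁻ φ f)

    Led⇒IsΠ : ∀ k φ → LEMΣ k → Led minus k φ → IsΠ k φ
    Led⇒IsΠ k (t ≐ s)  l f = toΠ (QF⇒Π k qf-eq)
    Led⇒IsΠ k ⊥'       l f = toΠ (QF⇒Π k qf-⊥)
    Led⇒IsΠ k (φ ∧' ψ) l f = IsΠ-∧ (Led⇒IsΠ k φ l (f ∘ Alt-∧ˡ φ ψ)) (Led⇒IsΠ k ψ l (f ∘ Alt-∧ʳ φ ψ))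
    Led⇒IsΠ k (φ ∨' ψ) l f = IsΠ-∨ l (Led⇒IsΠ k φ l (f ∘ Alt-∨ˡ φ ψ)) (Led⇒IsΠ k ψ l (f ∘ Alt-∨ʳ φ ψ))
    Led⇒IsΠ k (φ ⇒ ψ)  l f = IsΠ-resp (⇒-as-∨ (IsΣ-Dec l a)) (IsΠ-∨ l (IsΣ-¬ l a) (Led⇒IsΠ k ψ l (f ∘ Alt-⇒ʳ φ ψ)))
      where a = Led⇒IsΣ k φ l (Led-⇒ˡ minus φ ψ f)
    Led⇒IsΠ k (∀' φ)   l f = ∀-IsΠ k φ l (Led-∀⁻ φ f)
    Led⇒IsΠ zero    (∃' φ) l f = ⊥-elim (¬Led-0 minus (∃' φ) f)
    Led⇒IsΠ (suc k) (∃' φ) l f = IsΣ⇒IsΠ (∃-IsΣ k φ (LEMΣ-pred l) (Led-flip-∃⁻ φ f))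

    ∃-IsΣ : ∀ k φ → LEMΣ k → Led plus k φ → IsΣ k (∃' φ)
    ∃-IsΣ zero    φ l f = ⊥-elim (¬Led-0 plus φ f)
    ∃-IsΣ (suc k) φ l f = IsΣ-∃ (Led⇒IsΣ (suc k) φ l f)

    ∀-IsΠ : ∀ k φ → LEMΣ k → Led minus k φ → IsΠ k (∀' φ)
    ∀-IsΠ zero    φ l f = ⊥-elim (¬Led-0 minus φ f)
    ∀-IsΠ (suc k) φ l f = IsΠ-∀ (Led⇒IsΠ (suc k) φ l f)

  -- Decidability and the translation at bounded degree

  module _ {k} (l : LEMΣ k) where

    -- A formula of degree at most `k` is a propositional combination of atoms and quantified
    -- formulas, and each of the latter has a prenex form in `Σₖ k` or `Πₖ k`.
    F-Dec : ∀ φ → F k φ → Dec {Ax} φ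
    F-Dec (t ≐ s)  f = Dec-≐ t s
    F-Dec ⊥'       f = Dec-⊥
    F-Dec (φ ∧' ψ) f = Dec-∧ (F-Dec φ (f ∘ Alt-∧ˡ φ ψ)) (F-Dec ψ (f ∘ Alt-∧ʳ φ ψ))
    F-Dec (φ ∨' ψ) f = Dec-∨ (F-Dec φ (f ∘ Alt-∨ˡ φ ψ)) (F-Dec ψ (f ∘ Alt-∨ʳ φ ψ))
    F-Dec (φ ⇒ ψ)  f = Dec-⇒ (F-Dec φ (F-⇒ˡ φ ψ f)) (F-Dec ψ (f ∘ Alt-⇒ʳ φ ψ))
    -- `F k (∀' φ)` is `Led minus k φ` read through the mapped list of paths.
    F-Dec (∀' φ)   f = IsΠ-Dec l (∀-IsΠ k φ l (f ∘ ∈-map⁺ (cons minus)))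
    F-Dec (∃' φ)   f = IsΣ-Dec l (∃-IsΣ k φ l (f ∘ ∈-map⁺ (cons plus)))

    Dec-¬¬ : ∀ {φ ψ} → Dec {Ax} φ → φ ≈ ψ → φ ≈ ¬' (¬' ψ)
    Dec-¬¬ d (e , f) = ⇒I (⇒I (⇒E h0 (app₁ e h1)))
                     , ⇒I (Dec-stable d (app₁ (¬-mono (¬-mono f)) h0))

    F-N : ∀ φ → F k φ → φ ≈ N φ
    F-N (t ≐ s)  f = ⟺-refl
    F-N ⊥'       f = ⟺-refl
    F-N (φ ∧' ψ) f = ∧-cong (F-N φ (f ∘ Alt-∧ˡ φ ψ)) (F-N ψ (f ∘ Alt-∧ʳ φ ψ))
    F-N (φ ∨' ψ) f = Dec-¬¬ (F-Dec (φ ∨' ψ) f) (∨-cong (F-N φ (f ∘ Alt-∨ˡ φ ψ)) (F-N ψ (f ∘ Alt-∨ʳ φ ψ)))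
    F-N (φ ⇒ ψ)  f = ⇒-cong (F-N φ (F-⇒ˡ φ ψ f)) (F-N ψ (f ∘ Alt-⇒ʳ φ ψ))
      where
      ⇒-cong : ∀ {φ φ′ ψ ψ′} → φ ≈ φ′ → ψ ≈ ψ′ → (φ ⇒ ψ) ≈ (φ′ ⇒ ψ′)
      ⇒-cong (d , e) (d′ , e′) = ⇒I (⇒I (app₁ d′ (⇒E h1 (app₁ e h0)))) , ⇒I (⇒I (app₁ e′ (⇒E h1 (app₁ d h0))))
    F-N (∀' φ)   f = ∀-cong (F-N φ (Led⇒F minus φ (f ∘ ∈-map⁺ (cons minus))))
    F-N (∃' φ)   f = Dec-¬¬ (F-Dec (∃' φ) f) (∃-cong (F-N φ (Led⇒F plus φ (f ∘ ∈-map⁺ (cons plus)))))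

    mutual
      -- Proved together with `N⇒J`, since implication exchanges the classes. The double negation in
      -- `N⇒J` passes through existentials but not through universals, which matches the closure of
      -- `Jₛ` under the former only.
      R⇒N : ∀ {φ} → Rₛ k φ → Der Ax [] (φ ⇒ N φ)
      R⇒N {φ} (R-F f) = proj₁ (F-N φ (F⁺⇒F φ f))
      R⇒N (R-∧ a b)   = ∧-mono (R⇒N a) (R⇒N b)
      R⇒N (R-∨ a b)   = ⇒I (⇒I (⇒E h0 (app₁ (∨-mono (R⇒N a) (R⇒N b)) h1)))
      R⇒N (R-∀ a)     = ∀-mono (R⇒N a)
      R⇒N (R-⇒ {ψ = ψ} a b) = J⇒-N ψ (N⇒J a) (R⇒N b)

      N⇒J : ∀ {φ} → Jₛ k φ → Der Ax [] (N φ ⇒ ¬' (¬' φ))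
      N⇒J {φ} (J-F f) = ⇒I (⇒I (⇒E h0 (app₁ (proj₂ (F-N φ (F⁺⇒F φ f))) h1)))
      N⇒J (J-∧ a b)   = ⇒I (⇒I (⇒E (app₁ (N⇒J a) (∧E₁ h1)) (⇒I (⇒E (app₁ (N⇒J b) (∧E₂ h2)) (⇒I (⇒E h2 (∧I h1 h0)))))))
      N⇒J (J-∨ a b)   = ⇒I (⇒I (⇒E h1 (⇒I (∨E h0
                          (⇒E (app₁ (N⇒J a) h0) (⇒I (⇒E h3 (∨I₁ h0))))
                          (⇒E (app₁ (N⇒J b) h0) (⇒I (⇒E h3 (∨I₂ h0))))))))
      N⇒J (J-∃ {φ} a) = ⇒I (⇒I (⇒E h1 (⇒I (∃E h0 (⇒E (app₁ (N⇒J a) h0) (⇒I (⇒E h3 (∃in φ h0))))))))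
      N⇒J (J-⇒ a b)   = ⇒I (⇒I (⇒E h0 (⇒I (⊥E (⇒E (app₁ (N⇒J b) (⇒E h2 (app₁ (R⇒N a) h0))) (⇒I (⇒E h2 (⇒I h1))))))))

      -- The double negation on `φ` is harmless because the goal `N ψ` is stable.
      J⇒-N : ∀ {φ} ψ → Der Ax [] (N φ ⇒ ¬' (¬' φ)) → Der Ax [] (ψ ⇒ N ψ) → Der Ax [] ((φ ⇒ ψ) ⇒ (N φ ⇒ N ψ))
      J⇒-N ψ d e = ⇒I (⇒I (N-stable ψ (⇒I (⇒E (app₁ d h1) (⇒I (⇒E h1 (app₁ e (⇒E h3 h0))))))))

    -- Existentials may join universals here because only the direction into the translation is
    -- claimed; the converse direction is needed just for antecedents, which lie in `Jₛ`.
    Q⇒N : ∀ {φ} → Qₛ k φ → Der Ax [] (φ ⇒ N φ)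
    Q⇒N Q-eq        = ⇒I h0
    Q⇒N Q-⊥         = ⇒I h0
    Q⇒N (Q-∧ a b)   = ∧-mono (Q⇒N a) (Q⇒N b)
    Q⇒N (Q-∨ a b)   = ⇒I (⇒I (⇒E h0 (app₁ (∨-mono (Q⇒N a) (Q⇒N b)) h1)))
    Q⇒N (Q-∀ a)     = ∀-mono (Q⇒N a)
    Q⇒N (Q-∃ a)     = ⇒I (⇒I (⇒E h0 (app₁ (∃-mono (Q⇒N a)) h1)))
    Q⇒N (Q-⇒ {ψ = ψ} a b) = J⇒-N ψ (N⇒J a) (Q⇒N b)

  -- From the constant-domain rule to excluded middle

  IsEΠ : ℕ → Formula → Set
  IsEΠ k φ = ∃[ ψ ] EΠ k ψ × (φ ≈ ψ)

  toEΠ : ∀ {k φ} → EΠ k φ → IsEΠ k φ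
  toEΠ p = _ , p , ⟺-refl

  IsΠ⇒IsEΠ : ∀ {k φ} → IsΠ k φ → IsEΠ k φ
  IsΠ⇒IsEΠ (_ , p , e) = _ , eπ-base p , e

  IsEΠ-∨ : ∀ {k φ ψ} → IsEΠ k φ → IsEΠ k ψ → IsEΠ k (φ ∨' ψ)
  IsEΠ-∨ (_ , p , e) (_ , q , f) = _ , eπ-∨ p q , ∨-cong e f

  IsΠ-mono : ∀ {j k φ} → j ≤′ k → IsΠ j φ → IsΠ k φ
  IsΠ-mono ≤′-refl         p = p
  IsΠ-mono (≤′-step j≤′k) p with _ , q , e ← IsΠ-mono j≤′k p = _ , Π-suc q , e

  module _ {k} (cd : CD-R (EΠ k) T) where

    CD-IsEΠ : ∀ {φ ψ} → IsEΠ k φ → IsEΠ k ψ → Der Ax [] (shift φ ∨' ψ) → Der Ax [] (φ ∨' ∀' ψ)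
    CD-IsEΠ (φ′ , p , d , e) (ψ′ , q , d′ , e′) h =
      app₁ (∨-mono e (∀-mono e′)) (cd φ′ ψ′ p q (∀I (app₁ (∨-mono (substDer wk d) d′) h)))

    CD⇒LEMΣ : ∀ j → j < k → LEMΣ j
    CD⇒LEMΣ zero    j<k (Σ-qf q) = QF-Dec q
    CD⇒LEMΣ (suc j) j<k = dec
      where
      l : LEMΣ j
      l = CD⇒LEMΣ j (<⇒≤ j<k)

      dec : ∀ {φ} → Σₖ (suc j) φ → Dec {Ax} φ
      dec (Σ-Π p)           = Π-Dec j l p
      -- Peeling one existential at a time, the rule is applied to `∃' φ` and `¬' φ`. The former
      -- counts as a formula in `Πₖ (suc (suc j))`, which is where the strict bound `j < k` enters;
      -- the latter is equivalent to one in `Πₖ (suc j)`, given excluded middle at `j` only.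
      dec (Σ-∃ {φ = φ} s) = app₁ (∨-mono (⇒I h0) (proj₂ ¬∃-∀¬)) (CD-IsEΠ
        (IsΠ⇒IsEΠ (IsΠ-mono (≤⇒≤′ j<k) (toΠ (Π-Σ (Σ-∃ s)))))
        (IsΠ⇒IsEΠ (IsΠ-mono (≤⇒≤′ (<⇒≤ j<k)) (Σ-suc-¬ j l s)))
        (decide (dec s) (∨I₁ (∃in φ h0)) (∨I₂ h0)))

-- Conjunctions of EΠ formulas

data ConjEΠ (k : ℕ) : Formula → Set where
  one : ∀ {φ} → EΠ k φ → ConjEΠ k φ
  and : ∀ {φ ψ} → ConjEΠ k φ → ConjEΠ k ψ → ConjEΠ k (φ ∧' ψ)

-- Conjunctions are kept outermost, where conservativity can be checked conjunct by conjunct. The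
-- equivalence holds over every axiom set because `Approx-∀` uses one half in `T + X` and the other
-- in `PA + X`.
ConjEΠ-∀ : ∀ {k φ} → ConjEΠ k φ → ∃[ ψ ] ConjEΠ k ψ × (∀ {Ax} → _⟺_ {Ax} ψ (∀' φ))
ConjEΠ-∀ (one p) = _ , one (eπ-∀ p) , ⟺-refl
ConjEΠ-∀ (and p q) with ConjEΠ-∀ p | ConjEΠ-∀ q
... | _ , a , e | _ , b , f = _ , and a b , ⟺-trans (∧-cong e f) (⟺-sym ∀-∧-∀)

ConjEΠ-∨ : ∀ {k φ ψ} → ConjEΠ k φ → ConjEΠ k ψ → ∃[ χ ] ConjEΠ k χ × (∀ {Ax} → _⟺_ {Ax} χ (φ ∨' ψ))
ConjEΠ-∨ (one p) (one q) = _ , one (eπ-∨ p q) , ⟺-refl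
ConjEΠ-∨ (and p p′) q with ConjEΠ-∨ p q | ConjEΠ-∨ p′ q
... | _ , a , e | _ , b , f = _ , and a b , ⟺-trans (∧-cong e f) (⟺-sym ∨-distrib-∧ʳ)
ConjEΠ-∨ p@(one _) (and q q′) with ConjEΠ-∨ p q | ConjEΠ-∨ p q′
... | _ , a , e | _ , b , f = _ , and a b , ⟺-trans (∧-cong e f) (⟺-sym ∨-distrib-∧ˡ)

∨-assoc : ∀ {Ax φ ψ χ} → _⟺_ {Ax} ((φ ∨' ψ) ∨' χ) (φ ∨' (ψ ∨' χ))
∨-assoc = ⇒I (∨E h0 (∨E h0 (∨I₁ h0) (∨I₂ (∨I₁ h0))) (∨I₂ (∨I₂ h0)))
        , ⇒I (∨E h0 (∨I₁ (∨I₁ h0)) (∨E h0 (∨I₁ (∨I₂ h0)) (∨I₂ h0)))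

∨-swapʳ : ∀ {Ax φ ψ χ} → Der Ax [] ((φ ∨' ψ) ∨' χ ⇒ (φ ∨' χ) ∨' ψ)
∨-swapʳ = ⇒I (∨E h0 (∨E h0 (∨I₁ (∨I₁ h0)) (∨I₂ h0)) (∨I₁ (∨I₂ h0)))

-- Direct implications between the conditions

module _ {T X : Theory} (T⊆PA : SemiClassical T) where

  Der-PA+X : ∀ {φ} → (T + X) ⊢ φ → (PA + X) ⊢ φ
  Der-PA+X = mapAx λ
    { (inj₁ a)        → axiom (inj₁ a)
    ; (inj₂ (inj₁ t)) → mapAx (λ { (inj₁ a) → axiom (inj₁ a)
                                 ; (inj₂ b) → axiom (inj₂ (inj₁ b)) }) (T⊆PA _ t)
    ; (inj₂ (inj₂ x)) → axiom (inj₂ (inj₂ x)) }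

PA-Dec : ∀ {X} φ → Dec {Axioms (PA + X)} φ
PA-Dec φ = axiom (inj₂ (inj₁ (lem φ)))

Conservative⇒DNE-R : ∀ {Γ T X} → SemiClassical T → Conservative Γ (PA + X) (T + X) → DNE-R Γ (T + X)
Conservative⇒DNE-R T⊆PA c φ γ d = c φ γ (Dec-stable (PA-Dec φ) (Der-PA+X T⊆PA d))

-- Refuting the conclusion refutes `φ`, which leaves `ψ` for every value of the variable and so
-- proves the right disjunct.
¬¬-CD : ∀ {Ax φ ψ} → Der Ax [] (∀' (shift φ ∨' ψ)) → Der Ax [] (¬' (¬' (φ ∨' ∀' ψ)))
¬¬-CD {φ = φ} {ψ} d = ⇒I (⇒E h0 (∨I₂ (∀I
  (∨E (thm (∀-strip d)) (⊥E (⇒E h1 (∨I₁ h0))) h0))))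

DNE-R⇒CD-R : ∀ {Γ T} → (∀ φ ψ → Γ φ → Γ ψ → Γ (φ ∨' ∀' ψ)) → DNE-R Γ T → CD-R Γ T
DNE-R⇒CD-R closed dne φ ψ p q d = dne _ (closed φ ψ p q) (¬¬-CD d)

CD-R-U⇒EΠ : ∀ {k T} → CD-R (U k) T → CD-R (EΠ (suc k)) T
CD-R-U⇒EΠ {k} cd φ ψ p q d =
  app₁ (∨-mono (⇒I (∧E₂ h0)) (∀-mono (⇒I (∧E₂ h0))))
    (cd _ _ (padded-U p) (padded-U q)
      -- The left disjunct stands under `shift`, so its padding has to be proved in shifted form.
      (∀I (∨E (∀-strip d) (∨I₁ (∧I (thm (substDer wk P)) h0)) (∨I₂ (∧I (thm P) h0)))))
  where P = pad-provable minus (suc k)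

Conservative-U⇒EΠ : ∀ {k T T′} → Conservative (U k) T′ T → Conservative (EΠ (suc k)) T′ T
Conservative-U⇒EΠ {k} c φ p d = ∧E₂ (c _ (padded-U p) (∧I (pad-provable minus (suc k)) d))

-- Conservativity from the constant-domain rule

module FromCD {k : ℕ} {T X : Theory} (T⊆PA : SemiClassical T) (X⊆Q : ∀ φ → X φ → Qₛ k φ)
              (cd : CD-R (EΠ (suc k)) (T + X)) where

  open Hierarchy (T + X)

  private
    A B : Formula → Set
    A = Axioms (T + X)
    B = Axioms (PA + X)

    up : ∀ {φ} → Der A [] φ → Der B [] φ
    up = Der-PA+X T⊆PA

    lemΣ : LEMΣ k
    lemΣ = CD⇒LEMΣ cd k ≤-refl

  PA+X-N : ∀ {φ} → (PA + X) ⊢ φ → (T + X) ⊢ N φ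
  PA+X-N = translate λ
    { (inj₁ a)            → HAAx-N a
    ; (inj₂ (inj₁ e))     → LEM-N e
    ; (inj₂ (inj₂ x))     → app₁ (Q⇒N lemΣ (X⊆Q _ x)) (axiom (inj₂ (inj₂ x))) }

  -- Formulas in `Σₖ k` have degree at most `k`, so `T + X` can undo their translation.
  conservative-IsΣ : ∀ {δ} → IsΣ k δ → (PA + X) ⊢ δ → (T + X) ⊢ δ
  conservative-IsΣ (ψ , s , d , e) h = app₁ e (app₁ (proj₂ (F-N lemΣ ψ (Σ⇒F s))) (PA+X-N (app₁ (up d) h)))

  -- The quantification over σ makes this invariant under shifting, and δ collects the
  -- Σ_k-disjuncts met while an EΠ_{k+1} formula is taken apart.
  Descends : Formula → Set
  Descends χ = ∀ σ {δ} → IsΣ k δ → (PA + X) ⊢ (subst σ χ ∨' δ) → (T + X) ⊢ (subst σ χ ∨' δ)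

  Descends-⊥ : Descends ⊥'
  Descends-⊥ σ s d = ∨I₂ (conservative-IsΣ s (∨E d (⊥E h0) h0))

  Descends-shift : ∀ {χ} → Descends χ → Descends (shift χ)
  Descends-shift {χ} D σ {δ} s d = cast (sym e) (D (σ ⊙ wk) s (cast e d))
    where
    e : (subst σ (shift χ) ∨' δ) ≡ (subst (σ ⊙ wk) χ ∨' δ)
    e = cong (_∨' δ) (subst-⊙ σ wk χ)

  -- The new disjunct is absorbed into `δ`, which stays in the class because `lemΣ` closes it under
  -- disjunction.
  Descends-Σ : ∀ {χ φ} → Σₖ k φ → Descends χ → Descends (χ ∨' φ)
  Descends-Σ p D σ s d =
    app₁ (proj₂ ∨-assoc) (D σ (IsΣ-∨ lemΣ (toΣ (Σ-subst σ p)) s) (app₁ (proj₁ ∨-assoc) d))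

  -- The quantifier is opened in `PA + X`, the open disjunction is brought down to `T + X`, and the
  -- rule restores the quantifier there. The side formula of the rule is `χ` together with `δ`, the
  -- latter counted one level up as a `Πₖ (suc k)` formula.
  Descends-∀ : ∀ {χ φ} → EΠ (suc k) χ → EΠ (suc k) φ → Descends (shift χ ∨' φ) → Descends (χ ∨' ∀' φ)
  Descends-∀ {χ} {φ} p q D σ {δ} s d =
    -- The swaps bring the disjunct to be quantified to the right end and back.
    app₁ ∨-swapʳ (CD-IsEΠ cd
      (IsEΠ-∨ (toEΠ (EΠ-subst σ p)) (IsΠ⇒IsEΠ (IsΣ⇒IsΠ s))) (toEΠ (EΠ-subst (lift σ) q))
      (app₁ ∨-swapʳ (cast e (D (lift σ) (IsΣ-subst wk s) (cast (sym e) stripped)))))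
    where
    φσ = subst (lift σ) φ

    stripped : Der B [] ((shift (subst σ χ) ∨' φσ) ∨' shift δ)
    stripped = ∨E (substDer wk d) (∨E h0 (∨I₁ (∨I₁ h0)) (∨I₁ (∨I₂ (∀out φσ h0)))) (∨I₂ h0)

    e : ((subst (lift σ) (shift χ) ∨' φσ) ∨' shift δ) ≡ ((shift (subst σ χ) ∨' φσ) ∨' shift δ)
    e = cong (λ α → (α ∨' φσ) ∨' shift δ) (subst-shift σ χ)

  Descends-Π : ∀ {χ φ} → Πₖ (suc k) φ → EΠ (suc k) χ → Descends χ → Descends (χ ∨' φ)
  Descends-Π (Π-Σ s) q D = Descends-Σ s D
  Descends-Π {χ} (Π-∀ p) q D =
    Descends-∀ q (eπ-base p) (Descends-Π p (EΠ-subst wk q) (Descends-shift {χ} D))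

  -- `χ` accumulates the disjuncts already treated: for a disjunction the left half is processed
  -- first and then joins the accumulator for the right half.
  Descends-EΠ : ∀ {χ φ} → EΠ (suc k) φ → EΠ (suc k) χ → Descends χ → Descends (χ ∨' φ)
  Descends-EΠ (eπ-base p) q D = Descends-Π p q D
  Descends-EΠ {χ} (eπ-∨ {φ} {ψ} p p′) q D σ s d =
    app₁ (∨-mono (proj₁ ∨-assoc) (⇒I h0))
      (Descends-EΠ p′ (eπ-∨ q p) (Descends-EΠ p q D) σ s (app₁ (∨-mono (proj₂ ∨-assoc) (⇒I h0)) d))
  Descends-EΠ {χ} (eπ-∀ p) q D =
    Descends-∀ q p (Descends-EΠ p (EΠ-subst wk q) (Descends-shift {χ} D))

  conservative-EΠ : Conservative (EΠ (suc k)) (PA + X) (T + X)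
  conservative-EΠ φ p d = cast (subst-id φ)
    -- Accumulator and remainder both start as falsity and are discarded afterwards.
    (∨E (Descends-EΠ p (eπ-base (QF⇒Π (suc k) qf-⊥)) Descends-⊥ var {⊥'} (toΣ (QF⇒Σ k qf-⊥))
          (∨I₁ (∨I₂ (cast (sym (subst-id φ)) d))))
        (∨E h0 (⊥E h0) h0) (⊥E h0))

  -- From EΠ to U

  conservative-ConjEΠ : Conservative (ConjEΠ (suc k)) (PA + X) (T + X)
  conservative-ConjEΠ φ        (one p)   d = conservative-EΠ φ p d
  conservative-ConjEΠ (φ ∧' ψ) (and p q) d = ∧I (conservative-ConjEΠ φ p (∧E₁ d)) (conservative-ConjEΠ ψ q (∧E₂ d))

  -- The two implications live in different theories: classical reasoning is spent on the way from
  -- `φ` to `ψ`, before conservativity is applied, and the way back is taken inside `T + X`.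
  Approx : Formula → Set
  Approx φ = ∃[ ψ ] ConjEΠ (suc k) ψ × (T + X) ⊢ (ψ ⇒ φ) × (PA + X) ⊢ (φ ⇒ ψ)

  Approx-conv : ∀ {φ φ′} → (T + X) ⊢ (φ ⇒ φ′) → (PA + X) ⊢ (φ′ ⇒ φ) → Approx φ → Approx φ′
  Approx-conv d e (ψ , p , f , g) = ψ , p , ⇒-trans f d , ⇒-trans e g

  Approx-∧ : ∀ {φ ψ} → Approx φ → Approx ψ → Approx (φ ∧' ψ)
  Approx-∧ (_ , p , f , g) (_ , p′ , f′ , g′) = _ , and p p′ , ∧-mono f f′ , ∧-mono g g′

  Approx-∨ : ∀ {φ ψ} → Approx φ → Approx ψ → Approx (φ ∨' ψ)
  Approx-∨ (_ , p , f , g) (_ , p′ , f′ , g′) with ConjEΠ-∨ p p′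
  ... | _ , q , e = _ , q , ⇒-trans (proj₁ e) (∨-mono f f′) , ⇒-trans (∨-mono g g′) (proj₂ e)

  Approx-∀ : ∀ {φ} → Approx φ → Approx (∀' φ)
  Approx-∀ (_ , p , f , g) with ConjEΠ-∀ p
  ... | _ , q , e = _ , q , ⇒-trans (proj₁ e) (∀-mono f) , ⇒-trans (∀-mono g) (proj₂ e)

  Approx-IsΠ : ∀ {φ} → IsΠ (suc k) φ → Approx φ
  Approx-IsΠ (_ , p , f , g) = _ , one (eπ-base p) , g , up f

  Approx-QF : ∀ {φ} → QF φ → Approx φ
  Approx-QF q = Approx-IsΠ (toΠ (QF⇒Π (suc k) q))

  mutual
    -- At level `suc k` the theory `T + X` is only known to have excluded middle one level down, so
    -- disjunctions are not prenexed but kept as such in `EΠ`. The classical laws for pushing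
    -- negations inwards are used only in `PA + X`; their converses are intuitionistic.
    Led-Approx : ∀ φ → Led minus (suc k) φ → Approx φ
    Led-Approx (t ≐ s)  f = Approx-QF qf-eq
    Led-Approx ⊥'       f = Approx-QF qf-⊥
    Led-Approx (φ ∧' ψ) f = Approx-∧ (Led-Approx φ (f ∘ Alt-∧ˡ φ ψ)) (Led-Approx ψ (f ∘ Alt-∧ʳ φ ψ))
    Led-Approx (φ ∨' ψ) f = Approx-∨ (Led-Approx φ (f ∘ Alt-∨ˡ φ ψ)) (Led-Approx ψ (f ∘ Alt-∨ʳ φ ψ))
    Led-Approx (φ ⇒ ψ)  f = Approx-conv
      (⇒I (⇒I (∨E h1 (⊥E (⇒E h0 h1)) h0)))
      (proj₁ (⇒-as-∨ (PA-Dec φ)))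
      (Approx-∨ (Led-Approx-¬ φ (Led-⇒ˡ minus φ ψ f)) (Led-Approx ψ (f ∘ Alt-⇒ʳ φ ψ)))
    Led-Approx (∀' φ)   f = Approx-∀ (Led-Approx φ (Led-∀⁻ φ f))
    -- The opposite quantifier drops the level to `k`, where `lemΣ` provides a prenex form inside
    -- `T + X`.
    Led-Approx (∃' φ)   f = Approx-IsΠ (IsΣ⇒IsΠ (∃-IsΣ k φ lemΣ (Led-flip-∃⁻ φ f)))

    Led-Approx-¬ : ∀ φ → Led plus (suc k) φ → Approx (¬' φ)
    Led-Approx-¬ (t ≐ s)  f = Approx-QF (qf-⇒ qf-eq qf-⊥)
    Led-Approx-¬ ⊥'       f = Approx-QF (qf-⇒ qf-⊥ qf-⊥)
    Led-Approx-¬ (φ ∧' ψ) f = Approx-conv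
      (⇒I (⇒I (∨E h1 (⇒E h0 (∧E₁ h1)) (⇒E h0 (∧E₂ h1)))))
      (⇒I (decide (PA-Dec φ) (∨I₂ (⇒I (⇒E h2 (∧I h1 h0)))) (∨I₁ h0)))
      (Approx-∨ (Led-Approx-¬ φ (f ∘ Alt-∧ˡ φ ψ)) (Led-Approx-¬ ψ (f ∘ Alt-∧ʳ φ ψ)))
    Led-Approx-¬ (φ ∨' ψ) f = Approx-conv
      (⇒I (⇒I (∨E h0 (⇒E (∧E₁ h2) h0) (⇒E (∧E₂ h2) h0))))
      (⇒I (∧I (⇒I (⇒E h1 (∨I₁ h0))) (⇒I (⇒E h1 (∨I₂ h0)))))
      (Approx-∧ (Led-Approx-¬ φ (f ∘ Alt-∨ˡ φ ψ)) (Led-Approx-¬ ψ (f ∘ Alt-∨ʳ φ ψ)))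
    Led-Approx-¬ (φ ⇒ ψ)  f = Approx-conv
      (⇒I (⇒I (⇒E (∧E₂ h1) (⇒E h0 (∧E₁ h1)))))
      (⇒I (∧I (decide (PA-Dec φ) h0 (⊥E (⇒E h1 (⇒I (⊥E (⇒E h1 h0)))))) (⇒I (⇒E h1 (⇒I h1)))))
      (Approx-∧ (Led-Approx φ (Led-⇒ˡ plus φ ψ f)) (Led-Approx-¬ ψ (f ∘ Alt-⇒ʳ φ ψ)))
    Led-Approx-¬ (∀' φ)   f = Approx-IsΠ (IsΣ⇒IsΠ (IsΠ-¬ lemΣ (∀-IsΠ k φ lemΣ (Led-flip-∀⁻ φ f))))
    Led-Approx-¬ (∃' φ)   f = Approx-conv (proj₂ ¬∃-∀¬) (proj₁ ¬∃-∀¬) (Approx-∀ (Led-Approx-¬ φ (Led-∃⁻ φ f)))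

  conservative-U : Conservative (U k) (PA + X) (T + X)
  conservative-U φ u d with Led-Approx φ (U⇒Led φ u)
  ... | ψ , p , f , g = app₁ f (conservative-ConjEΠ ψ p (app₁ g d))

theorem5p16 : (k : ℕ) (T X : Theory) → SemiClassical T →
    (∀ φ → X φ → Sentence φ × Qₛ k φ) →
    let c1 = Conservative (U k) (PA + X) (T + X)
        c2 = Conservative (EΠ (suc k)) (PA + X) (T + X)
        c3 = DNE-R (EΠ (suc k)) (T + X)
        c4 = CD-R (EΠ (suc k)) (T + X)
        c5 = DNE-R (U k) (T + X)
        c6 = CD-R (U k) (T + X)
    in (c1 ⇔ c2) × (c1 ⇔ c3) × (c1 ⇔ c4) × (c1 ⇔ c5) × (c1 ⇔ c6)
-- Two cycles through `c1` give all equivalences: `c1`, `c2`, `c3`, `c4` and `c1`, `c5`, `c6`, `c4`,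
-- both closed by `c4⇒c1`.
theorem5p16 k T X T⊆PA X⊆Q =
    mk⇔ c1⇒c2 (c4⇒c1 ∘ c3⇒c4 ∘ c2⇒c3)
  , mk⇔ (c2⇒c3 ∘ c1⇒c2) (c4⇒c1 ∘ c3⇒c4)
  , mk⇔ (c3⇒c4 ∘ c2⇒c3 ∘ c1⇒c2) c4⇒c1
  , mk⇔ c1⇒c5 (c4⇒c1 ∘ c6⇒c4 ∘ c5⇒c6)
  , mk⇔ (c5⇒c6 ∘ c1⇒c5) (c4⇒c1 ∘ c6⇒c4)
  where
  c1⇒c2 : Conservative (U k) (PA + X) (T + X) → Conservative (EΠ (suc k)) (PA + X) (T + X)
  c1⇒c2 = Conservative-U⇒EΠ

  c2⇒c3 : Conservative (EΠ (suc k)) (PA + X) (T + X) → DNE-R (EΠ (suc k)) (T + X)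
  c2⇒c3 = Conservative⇒DNE-R T⊆PA

  c3⇒c4 : DNE-R (EΠ (suc k)) (T + X) → CD-R (EΠ (suc k)) (T + X)
  c3⇒c4 = DNE-R⇒CD-R (λ _ _ p q → eπ-∨ p (eπ-∀ q))

  c4⇒c1 : CD-R (EΠ (suc k)) (T + X) → Conservative (U k) (PA + X) (T + X)
  c4⇒c1 = FromCD.conservative-U T⊆PA (λ φ x → proj₂ (X⊆Q φ x))

  c1⇒c5 : Conservative (U k) (PA + X) (T + X) → DNE-R (U k) (T + X)
  c1⇒c5 = Conservative⇒DNE-R T⊆PA

  c5⇒c6 : DNE-R (U k) (T + X) → CD-R (U k) (T + X)
  c5⇒c6 = DNE-R⇒CD-R U-∨∀

  c6⇒c4 : CD-R (U k) (T + X) → CD-R (EΠ (suc k)) (T + X)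
  c6⇒c4 = CD-R-U⇒EΠ
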